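{- For every tree $T$, if $\mathrm{lmw}(T)=k$ then $k\le \mathrm{lmw}(T^2)\le 2k$. Moreover, both bounds are tight for every $k\ge 0$: for every integer $k\ge 0$ there exists a tree $T$ with $\mathrm{lmw}(T)=\mathrm{lmw}(T^2)=k$, and there exists a tree $T'$ with $\mathrm{lmw}(T')=k$ and $\mathrm{lmw}(T'^2)=2k$.
   Context: All graphs are finite and simple. For a graph $G$, its square $G^2$ is the graph on $V(G)$ in which two distinct vertices are adjacent iff their distance in $G$ is at most $2$. For disjoint $S,T\subseteq V(G)$, $G[S,T]$ denotes the bipartite graph on $S\cup T$ whose edges are exactly the edges of $G$ with one endpoint in $S$ and the other in $T$. $\mathrm{mim}(H)$ is the maximum number of edges in an induced matching of $H$. A linear layout of an $n$-vertex graph $G$ is a bijection $\sigma:V(G)\to\{1,\dots,n\}$; write $v_i=\sigma^{ -1}(i)$ and $V_i^\sigma=\{v_1,\dots,v_i\}$, $\overline{V_i^\sigma}=V(G)\setminus V_i^\sigma$. The MIM-width of $G$ under $\sigma$ is $\mathrm{mw}(\sigma,G)=\max_{1\le i<n}\mathrm{mim}(G[V_i^\sigma,\overline{V_i^\sigma}])$ (equal to $0$ if $n\le 1$). The linear MIM-width $\mathrm{lmw}(G)$ is the minimum of $\mathrm{mw}(\sigma,G)$ over all linear layouts $\sigma$ of $G$. -}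

module Defs where

open import Data.Fin.Base using (Fin; zero; suc; toℕ; fromℕ; inject₁)
open import Data.Fin.Permutation as Perm using (Permutation′; permutation; _⟨$⟩ʳ_; _⟨$⟩ˡ_)
open import Data.Fin.Properties as Fin using (any?; all?; injective⇒≤)
open import Data.Fin.Subset using (Subset; _∈_; ∁)
open import Data.Fin.Subset.Properties using (_∈?_)
open import Data.List.Base using (List; applyUpTo)
open import Data.List.Extrema.Nat using (max)
open import Data.Nat.Base using (ℕ; zero; suc; _+_; _∸_; _≤_; _<_; NonZero; s≤s; s≤s⁻¹)
open import Data.Nat.Induction using (<-rec)
open import Data.Nat.Properties as ℕ using (_<?_; anyUpTo?)
open import Data.Product.Base using (Σ; ∃; ∃-syntax; _×_; _,_; proj₁; proj₂)
open import Data.Sum.Base using (_⊎_; inj₁; inj₂)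
open import Data.Vec.Base using (Vec; []; _∷_; lookup; tabulate)
open import Data.Vec.Properties using (lookup∘tabulate; tabulate-cong)
open import Function.Base using (_∘_)
open import Function.Definitions using (Injective)
open import Level using (0ℓ)
open import Relation.Binary.Core using (Rel)
import Relation.Binary.Definitions as B
open import Relation.Binary.PropositionalEquality
  using (_≡_; _≢_; _≗_; refl; sym; trans; cong; cong₂; subst)
open import Relation.Nullary
  using (¬_; Dec; yes; no; does; contradiction; ¬?; _×-dec_; _⊎-dec_; _→-dec_)
open import Relation.Nullary.Decidable using (map′; decidable-stable)
open import Relation.Unary using (Pred; Decidable)

private
  variable
    n : ℕ

-- Decidability of adjacency is automatic classically; here it makes the
-- extremal parameters below well defined.
record Graph (n : ℕ) : Set₁ where
  field
    Adj        : Rel (Fin n) 0ℓ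
    adj?       : B.Decidable Adj
    adj-sym    : B.Symmetric Adj
    adj-irrefl : ∀ {u} → ¬ Adj u u

open Graph public

data Walk (G : Graph n) : ℕ → Fin n → Fin n → Set where
  []  : ∀ {u} → Walk G 0 u u
  _∷_ : ∀ {l u v w} → Adj G u v → Walk G l v w → Walk G (suc l) u w

Dist≤ : Graph n → ℕ → Fin n → Fin n → Set
Dist≤ G d u v = ∃[ l ] l ≤ d × Walk G l u v

Connected : Graph n → Set
Connected G = ∀ u v → ∃[ l ] Walk G l u v

-- A cycle on the 3 + m pairwise distinct vertices c 0, …, c (2 + m).
record Cycle (G : Graph n) (m : ℕ) : Set where
  field
    c        : Fin (3 + m) → Fin n
    distinct : Injective _≡_ _≡_ c
    step     : ∀ (i : Fin (2 + m)) → Adj G (c (inject₁ i)) (c (suc i))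
    close    : Adj G (c (fromℕ (2 + m))) (c zero)

record IsTree {n : ℕ} (G : Graph n) : Set where
  field
    nonEmpty  : NonZero n
    connected : Connected G
    acyclic   : ∀ m → ¬ Cycle G m

private
  _++ʷ_ : ∀ {G : Graph n} {k l u v w} → Walk G k u v → Walk G l v w → Walk G (k + l) u w
  []      ++ʷ q = q
  (e ∷ p) ++ʷ q = e ∷ (p ++ʷ q)

  reverseʷ : ∀ {G : Graph n} {l u v} → Walk G l u v → Walk G l v u
  reverseʷ [] = []
  reverseʷ {G = G} {suc l} {u} {v} (e ∷ p) =
    subst (λ k → Walk G k v u) (ℕ.+-comm l 1) (reverseʷ p ++ʷ (adj-sym G e ∷ []))

  walk? : ∀ (G : Graph n) l u v → Dec (Walk G l u v)
  walk? G zero    u v = map′ (λ { refl → [] }) (λ { [] → refl }) (u Fin.≟ v)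
  walk? G (suc l) u v =
    map′ (λ { (_ , e , p) → e ∷ p }) (λ { (e ∷ p) → _ , e , p })
      (any? λ w → adj? G u w ×-dec walk? G l w v)

  dist≤? : ∀ (G : Graph n) d u v → Dec (Dist≤ G d u v)
  dist≤? G d u v =
    map′ (λ { (l , l<1+d , p) → l , s≤s⁻¹ l<1+d , p })
         (λ { (l , l≤d , p) → l , s≤s l≤d , p })
      (anyUpTo? (λ l → walk? G l u v) (suc d))

infix 9 _²

_² : Graph n → Graph n
Adj        (G ²) u v = u ≢ v × Dist≤ G 2 u v
adj?       (G ²) u v = ¬? (u Fin.≟ v) ×-dec dist≤? G 2 u v
adj-sym    (G ²) (u≢v , l , l≤2 , p) = u≢v ∘ sym , l , l≤2 , reverseʷ p
adj-irrefl (G ²) (u≢u , _) = u≢u refl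

-- The vertex set stays Fin n: vertices outside S and T are isolated, which
-- does not affect induced matchings, and there are none when T is ∁ S.
bipartite : Graph n → Subset n → Subset n → Graph n
Adj        (bipartite G S T) u v = Adj G u v × ((u ∈ S × v ∈ T) ⊎ (u ∈ T × v ∈ S))
adj?       (bipartite G S T) u v =
  adj? G u v ×-dec ((u ∈? S ×-dec v ∈? T) ⊎-dec (u ∈? T ×-dec v ∈? S))
adj-sym    (bipartite G S T) (e , inj₁ (u∈S , v∈T)) = adj-sym G e , inj₂ (v∈T , u∈S)
adj-sym    (bipartite G S T) (e , inj₂ (u∈T , v∈S)) = adj-sym G e , inj₁ (v∈S , u∈T)
adj-irrefl (bipartite G S T) (e , _) = adj-irrefl G e

IsMaximum IsMinimum : Pred ℕ 0ℓ → Pred ℕ 0ℓ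
IsMaximum P m = P m × (∀ k → P k → k ≤ m)
IsMinimum P m = P m × (∀ k → P k → m ≤ k)

_∈ₑ_ : Fin n → Fin n × Fin n → Set
x ∈ₑ (u , v) = x ≡ u ⊎ x ≡ v

-- The edges are listed without repetition, by disjointness.
record IsInducedMatching (H : Graph n) {k : ℕ} (e : Fin k → Fin n × Fin n) : Set where
  field
    edge     : ∀ i → Adj H (proj₁ (e i)) (proj₂ (e i))
    disjoint : ∀ i j → i ≢ j → ∀ x y → x ∈ₑ e i → y ∈ₑ e j → x ≢ y
    induced  : ∀ i j → i ≢ j → ∀ x y → x ∈ₑ e i → y ∈ₑ e j → ¬ Adj H x y

HasInducedMatching : Graph n → ℕ → Set
HasInducedMatching {n} H k = ∃[ e ] IsInducedMatching H {k} e

private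
  Searchable : Set → Set₁
  Searchable A = ∀ {P : Pred A 0ℓ} → Decidable P → Dec (∃ P)

  pair? : ∀ {m n} → Searchable (Fin m × Fin n)
  pair? P? = map′ (λ { (x , y , p) → (x , y) , p }) (λ { ((x , y) , p) → x , y , p })
    (any? λ x → any? λ y → P? (x , y))

  vec? : ∀ {A} k → Searchable A → Searchable (Vec A k)
  vec? zero    A? P? = map′ ([] ,_) (λ { ([] , p) → p }) (P? [])
  vec? (suc k) A? P? = map′ (λ { (x , xs , p) → x ∷ xs , p }) (λ { (x ∷ xs , p) → x , xs , p })
    (A? λ x → vec? k A? λ xs → P? (x ∷ xs))

  least : ∀ {P} → Decidable P → ∃ P → ∃ (IsMinimum P)
  least {P} P? (m , pm) = <-rec (λ m → P m → ∃ (IsMinimum P)) go m pm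
    where
    go : ∀ m → (∀ {k} → k < m → P k → ∃ (IsMinimum P)) → P m → ∃ (IsMinimum P)
    go m rec pm with anyUpTo? P? m
    ... | yes (k , k<m , pk) = rec k<m pk
    ... | no  ∄              = m , pm , λ k pk → ℕ.≮⇒≥ λ k<m → ∄ (k , k<m , pk)

  greatest : ∀ {P} → Decidable P → ∃ P → ∀ b → (∀ k → P k → k ≤ b) → ∃ (IsMaximum P)
  greatest {P} P? (m , pm) b bound with P? b
  greatest P? (m , pm) b       bound | yes pb = b , pb , bound
  greatest {P} P? (m , pm) zero    bound | no ¬p0 =
    contradiction (subst P (ℕ.n≤0⇒n≡0 (bound m pm)) pm) ¬p0
  greatest {P} P? (m , pm) (suc b) bound | no ¬pb = greatest P? (m , pm) b λ k pk →
    s≤s⁻¹ (ℕ.≤∧≢⇒< (bound k pk) λ { refl → ¬pb pk })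

  isInducedMatching? : ∀ (H : Graph n) {k} → Decidable (IsInducedMatching H {k})
  isInducedMatching? H e =
    map′ (λ { (a , b , c) → record { edge = a ; disjoint = b ; induced = c } })
         (λ M → let open IsInducedMatching M in edge , disjoint , induced)
      ( all? (λ i → adj? H _ _)
      ×-dec across? (λ x y → ¬? (x Fin.≟ y))
      ×-dec across? (λ x y → ¬? (adj? H x y)))
    where
    across? : ∀ {R : Rel (Fin _) 0ℓ} → B.Decidable R →
              Dec (∀ i j → i ≢ j → ∀ x y → x ∈ₑ e i → y ∈ₑ e j → R x y)
    across? R? = all? λ i → all? λ j → ¬? (i Fin.≟ j) →-dec
      all? λ x → all? λ y → (x Fin.≟ _ ⊎-dec x Fin.≟ _) →-dec
        ((y Fin.≟ _ ⊎-dec y Fin.≟ _) →-dec R? x y)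

  resp : ∀ {H : Graph n} {k} {e f : Fin k → Fin n × Fin n} →
         e ≗ f → IsInducedMatching H e → IsInducedMatching H f
  resp {H = H} e≗f M = record
    { edge     = λ i → subst (λ p → Adj H (proj₁ p) (proj₂ p)) (e≗f i) (edge i)
    ; disjoint = λ i j i≢j x y x∈ y∈ → disjoint i j i≢j x y (back x∈) (back y∈)
    ; induced  = λ i j i≢j x y x∈ y∈ → induced i j i≢j x y (back x∈) (back y∈)
    }
    where
    open IsInducedMatching M
    back : ∀ {x i} → x ∈ₑ _ → x ∈ₑ _
    back {x} {i} = subst (x ∈ₑ_) (sym (e≗f i))

  hasInducedMatching? : ∀ (H : Graph n) → Decidable (HasInducedMatching H)
  hasInducedMatching? H k =
    map′ (λ { (v , M) → lookup v , M })
         (λ { (e , M) → tabulate e , resp (sym ∘ lookup∘tabulate e) M })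
      (vec? k pair? λ v → isInducedMatching? H (lookup v))

  size≤order : ∀ (H : Graph n) k → HasInducedMatching H k → k ≤ n
  size≤order H k (e , M) = injective⇒≤ {f = proj₁ ∘ e} λ {i} {j} eq →
    decidable-stable (i Fin.≟ j) λ i≢j →
      IsInducedMatching.disjoint M i j i≢j _ _ (inj₁ refl) (inj₁ refl) eq

abstract
  mim-exists : ∀ (H : Graph n) → ∃ (IsMaximum (HasInducedMatching H))
  mim-exists {n} H = greatest (hasInducedMatching? H) (0 , (λ ()) , none) n (size≤order H)
    where
    none : IsInducedMatching H {0} λ ()
    none = record { edge = λ () ; disjoint = λ () ; induced = λ () }

mim : Graph n → ℕ
mim H = proj₁ (mim-exists H)

-- σ takes values in Fin n, so the i-th vertex v_i is the one with
-- toℕ (σ ⟨$⟩ʳ v_i) ≡ i ∸ 1.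
Layout : ℕ → Set
Layout = Permutation′

-- V_i = {v_1, …, v_i}
prefix : Layout n → ℕ → Subset n
prefix σ i = tabulate λ v → does (toℕ (σ ⟨$⟩ʳ v) <? i)

cut : Layout n → Graph n → ℕ → Graph n
cut σ G i = bipartite G (prefix σ i) (∁ (prefix σ i))

-- The index i = suc j ranges over 1 ≤ i < n.
mw : Layout n → Graph n → ℕ
mw {n} σ G = max 0 (applyUpTo (λ j → mim (cut σ G (suc j))) (n ∸ 1))

IsWidth : Graph n → ℕ → Set
IsWidth {n} G k = Σ (Layout n) λ σ → mw σ G ≡ k

private
  mw-cong : ∀ {σ τ : Layout n} (G : Graph n) → σ Perm.≈ τ → mw σ G ≡ mw τ G
  mw-cong {n} {σ} {τ} G σ≈τ = cong (max 0) (go (n ∸ 1) suc)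
    where
    mimAt : Subset _ → ℕ
    mimAt S = mim (bipartite G S (∁ S))
    same : ∀ i → prefix σ i ≡ prefix τ i
    same i = tabulate-cong λ v → cong (λ w → does (toℕ w <? i)) (σ≈τ v)
    go : ∀ m (f : ℕ → ℕ) → applyUpTo (mimAt ∘ prefix σ ∘ f) m ≡ applyUpTo (mimAt ∘ prefix τ ∘ f) m
    go zero    f = refl
    go (suc m) f = cong₂ List._∷_ (cong mimAt (same (f 0))) (go m (f ∘ suc))

  layout? : ∀ {P : Pred (Layout n) 0ℓ} → (∀ {σ τ} → σ Perm.≈ τ → P σ → P τ) →
            Decidable P → Dec (∃ P)
  layout? {n} {P} P-resp P? =
    map′ (λ { (_ , _ , l , r , p) → permutation _ _ l r , p })
         (λ { (σ , p) → encode σ p })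
      (vec? n any? λ f → vec? n any? λ g → code? f g)
    where
    Code : Vec (Fin n) n → Vec (Fin n) n → Set
    Code f g = Σ (∀ i → lookup f (lookup g i) ≡ i) λ l →
               Σ (∀ i → lookup g (lookup f i) ≡ i) λ r →
               P (permutation (lookup f) (lookup g) l r)

    code? : ∀ f g → Dec (Code f g)
    code? f g with all? (λ i → lookup f (lookup g i) Fin.≟ i)
                 | all? (λ i → lookup g (lookup f i) Fin.≟ i)
    ... | no ¬l | _     = no λ { (l , _) → ¬l l }
    ... | yes _ | no ¬r = no λ { (_ , r , _) → ¬r r }
    ... | yes l | yes r =
      map′ (λ p → l , r , p) (λ { (_ , _ , p) → P-resp (λ _ → refl) p }) (P? _)

    encode : ∀ σ → P σ → ∃ λ f → ∃ λ g → Code f g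
    encode σ p = tabulate to , tabulate from ,
      (λ i → trans (lookup∘tabulate to _) (trans (cong to (lookup∘tabulate from i)) (Perm.inverseʳ σ))) ,
      (λ i → trans (lookup∘tabulate from _) (trans (cong from (lookup∘tabulate to i)) (Perm.inverseˡ σ))) ,
      P-resp (λ i → sym (lookup∘tabulate to i)) p
      where
      to from : Fin n → Fin n
      to   = σ ⟨$⟩ʳ_
      from = σ ⟨$⟩ˡ_

abstract
  lmw-exists : ∀ (G : Graph n) → ∃ (IsMinimum (IsWidth G))
  lmw-exists G = least
    (λ k → layout? (λ {σ} {τ} σ≈τ eq → trans (sym (mw-cong {σ = σ} {τ} G σ≈τ)) eq)
                   (λ σ → mw σ G ℕ.≟ k))
    (mw Perm.id G , Perm.id , refl)

lmw : Graph n → ℕ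
lmw G = proj₁ (lmw-exists G)

{-# OPTIONS --safe #-}

-- Upper bound: the same layout serves T and T², because a crossing edge ab of T² is a path with
-- a crossing edge of T at a or at b, and the crossing edges found on the same side keep a
-- matching induced.
--
-- Lower bound: by induction on m, either T has a layout of width m or T² has width at least
-- m + 1 under every ordering. Call a neighbour c of x heavy if some tree hanging below c (away
-- from x) has square width at least m + 1. Three heavy neighbours of x force square width
-- m + 2: at the cut belonging to the middle one, the other two are joined in T² by an edge
-- between the two heavy neighbours, which stays at distance three from the middle trees. If no
-- vertex has three heavy neighbours, walking to heavy neighbours from a vertex with two of them
-- (or from any vertex) traces a path, and laying out the light trees along it costs one more
-- than their width.
--
-- Sharpness: three copies joined at distance three raise both widths by one, and three copies
-- whose attached roots form a triangle in T², three times over, raise the width of T by one but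
-- that of T² by two.

module Submission where

open import Defs
open import Data.Bool.Base using (true)
open import Data.Empty using (⊥)
open import Data.Fin.Base as Fin using (Fin; zero; suc; toℕ)
open import Data.Fin.Permutation using (permutation; _⟨$⟩ʳ_; _⟨$⟩ˡ_; inverseˡ)
import Data.Fin.Properties as Fin
open import Data.Fin.Relation.Unary.Top using (view; ‵fromℕ; ‵inject₁)
open import Data.Fin.Subset using (Subset; ∁) renaming (_∈_ to _∈ˢ_; _∉_ to _∉ˢ_)
open import Data.Fin.Subset.Properties using (x∈∁p⇒x∉p; x∉p⇒x∈∁p)
open import Data.List.Base
  using (List; []; _∷_; _++_; [_]; head; length; map; reverse; take; drop; lookup; tabulate; allFin; applyUpTo)
import Data.List.Extrema.Nat as Extrema
open import Data.List.Membership.DecPropositional using () renaming (_∈?_ to member?)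
open import Data.List.Membership.Propositional using (_∈_; _∉_)
open import Data.List.Membership.Propositional.Properties
  using (∈-++⁻; ∈-++⁺ˡ; ∈-++⁺ʳ; ∈-map⁺; ∈-map⁻; ∈-∃++; ∈-lookup; ∈-allFin)
open import Data.List.Properties
  using (++-assoc; ++-identityʳ; length-map; length-++; length-tabulate; map-++; reverse-++; reverse-involutive;
         unfold-reverse; take++drop≡id; ≡-dec; ∷-injective)
open import Data.List.Relation.Binary.Permutation.Propositional
  using (_↭_; ↭-sym; ↭-trans; ↭-refl; ↭-reflexive; ↭⇒↭ₛ; prep; swap; refl; trans; module PermutationReasoning)
open import Data.List.Relation.Binary.Permutation.Propositional.Properties
  using (All-resp-↭; ∈-resp-↭; ↭-length; ↭-reverse; drop-∷; shift; shifts; ++-comm; ++⁺; ++⁺ˡ)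
import Data.List.Relation.Binary.Permutation.Setoid.Properties as Permₛ
open import Data.List.Relation.Binary.Pointwise.Base using (Pointwise; []; _∷_)
open import Data.List.Relation.Unary.All as All using (All; []; _∷_)
import Data.List.Relation.Unary.All.Properties as Allₚ
open import Data.List.Relation.Unary.AllPairs as AllPairs using (AllPairs; []; _∷_)
import Data.List.Relation.Unary.AllPairs.Properties as AllPairsₚ
open import Data.List.Relation.Unary.Any using (here; there; index)
import Data.List.Relation.Unary.Any.Properties as Anyₚ
open import Data.List.Relation.Unary.Unique.Propositional using (Unique)
open import Data.Nat.Base using (ℕ; zero; suc; _+_; _*_; _∸_; _≤_; _<_; z≤n; s≤s; NonZero)
import Data.Nat.Properties as ℕ
open import Data.Product.Base as Prod using (Σ; Σ-syntax; ∃-syntax; ∃₂; _×_; _,_; proj₁; proj₂)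
open import Data.Sum.Base as Sum using (_⊎_; inj₁; inj₂)
open import Data.Unit.Base using (⊤)
open import Data.Vec.Properties using (lookup⇒[]=; []=⇒lookup; lookup∘tabulate)
open import Function.Base using (_∘_; id)
open import Level using (0ℓ)
open import Relation.Binary.Construct.Closure.ReflexiveTransitive as Star using (Star; ε; _◅_; _◅◅_)
open import Relation.Binary.Core using (Rel)
open import Relation.Binary.Definitions using (Symmetric; tri<; tri≈; tri>)
open import Relation.Binary.PropositionalEquality as ≡ using (_≡_; _≢_; refl; cong; subst)
open import Relation.Nullary using (¬_; Dec; does; yes; no; contradiction; _⊎-dec_)
open import Relation.Nullary.Decidable using (dec-true)
open import Relation.Unary using (Decidable)

-- In the square the roots of sibling subtrees are pairwise adjacent, so a matching that used the
-- root of the middle tree could clash with the separating edge between the other two roots. Lower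
-- bounds therefore carry two vertex lists: the cut may be placed anywhere in a subtree, while the
-- matching has to avoid its root. Heaviness records this loss of one level: it concerns the trees
-- below a neighbour and not the tree of the neighbour itself.
--
-- The layouts can afford the same loss. With `x` in front and every light neighbour `v` placed
-- behind the trees below it, the edges that leave these trees either start in `x` or end in `v`,
-- and any two of them conflict because `x` is adjacent to `v`. Two levels of branching thus cost
-- the tree one, while they can gain two in the square; the family with factor two is built on this.
--
-- Neighbours of a vertex include its parent, so the trees are rerooted along the walk. A heavy
-- subtree stays heavy when it is viewed from further away, which keeps the side already left behind
-- heavy.

private
  variable
    n : ℕ
    A V : Set

-- Induced matchings across a cut and the width of an ordering

AllPairs-resp-↭ : ∀ {R : Rel A 0ℓ} → Symmetric R → ∀ {xs ys} → xs ↭ ys → AllPairs R xs → AllPairs R ys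
AllPairs-resp-↭ {A} R-sym xs↭ys =
  Permₛ.AllPairs-resp-↭ (≡.setoid A) R-sym ((λ { refl → id }) , (λ { refl → id })) (↭⇒↭ₛ xs↭ys)

++-split : ∀ (A B X Y : List V) → A ++ B ≡ X ++ Y →
           (∃[ C ] X ≡ A ++ C × B ≡ C ++ Y) ⊎ (∃[ C ] A ≡ X ++ C × Y ≡ C ++ B)
++-split []      B X       Y eq   = inj₁ (X , refl , eq)
++-split (a ∷ A) B []      Y eq   = inj₂ (a ∷ A , refl , ≡.sym eq)
++-split (a ∷ A) B (x ∷ X) Y eq with refl ← cong head eq
  with ++-split A B X Y (cong (drop 1) eq)
... | inj₁ (C , refl , eqB) = inj₁ (C , refl , eqB)
... | inj₂ (C , refl , eqY) = inj₂ (C , refl , eqY)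

∷ʳ-split : ∀ (A B X : List V) {v} → A ++ B ≡ X ++ [ v ] →
           (∃[ C ] X ≡ A ++ C × B ≡ C ++ [ v ]) ⊎ B ≡ []
∷ʳ-split A B X {v} eq with ++-split A B X [ v ] eq
... | inj₁ s                     = inj₁ s
... | inj₂ ([]     , refl , refl) = inj₁ ([] , ≡.sym (≡.trans (++-identityʳ _) (++-identityʳ _)) , refl)
... | inj₂ (_ ∷ C , _ , eq′)     = inj₂ (tail-empty C (cong (drop 1) eq′))
  where
  tail-empty : ∀ (C : List _) {B} → [] ≡ C ++ B → B ≡ []
  tail-empty [] e = ≡.sym e

-- Disjointness comes for free: if two edges satisfying `Q` share a left or a right end, then
-- `Q a b′` or `Q a′ b` is one of these edges.
Compatible : Rel V 0ℓ → Rel (V × V) 0ℓ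
Compatible Q (a , b) (a′ , b′) = ¬ Q a b′ × ¬ Q a′ b

Compatible-sym : ∀ (Q : Rel V 0ℓ) → Symmetric (Compatible Q)
Compatible-sym Q (p , q) = q , p

Crossing : Rel V 0ℓ → (A B : V → Set) → V × V → Set
Crossing Q A B (a , b) = A a × B b × Q a b

-- An induced matching of the bipartite graph Q[A,B], each edge being listed from A to B.
Matching : Rel V 0ℓ → (A B : V → Set) → List (V × V) → Set
Matching Q A B M = All (Crossing Q A B) M × AllPairs (Compatible Q) M

module _ {Q : Rel V 0ℓ} where

  Matching-mapAll : ∀ {A B A′ B′ M} → (∀ {e} → Crossing Q A B e → Crossing Q A′ B′ e) →
                    Matching Q A B M → Matching Q A′ B′ M
  Matching-mapAll f (cs , ps) = All.map f cs , ps

  -- Among pairwise incompatible edges a matching contains at most one.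
  extract : ∀ {P R : V × V → Set} → (∀ {e f} → R e → R f → ¬ Compatible Q e f) →
            ∀ {M} → All (λ e → P e ⊎ R e) M → AllPairs (Compatible Q) M →
            All P M ⊎ (∃₂ λ e M′ → M ↭ e ∷ M′ × R e × All P M′)
  extract conflict [] [] = inj₁ []
  extract conflict {e ∷ M} (inj₁ p ∷ prs) (_ ∷ cs) with extract conflict prs cs
  ... | inj₁ ps                       = inj₁ (p ∷ ps)
  ... | inj₂ (f , M′ , M↭ , r , ps) =
    inj₂ (f , e ∷ M′ , ↭-trans (prep e M↭) (swap e f ↭-refl) , r , p ∷ ps)
  extract {P} {R} conflict {e ∷ M} (inj₂ r ∷ prs) (c ∷ cs) = inj₂ (e , M , ↭-refl , r , only prs c)
    where
    only : ∀ {N} → All (λ f → P f ⊎ R f) N → All (Compatible Q e) N → All P N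
    only []              []       = []
    only (inj₁ p ∷ prs) (_ ∷ cs) = p ∷ only prs cs
    only (inj₂ s ∷ prs) (c ∷ cs) = contradiction c (conflict r s)

  -- The counting behind most bounds of the form `suc k`: whatever crosses outside a region of width
  -- `k` is pairwise in conflict and so adds at most one edge.
  one-outside : ∀ {P R : V × V → Set} → (∀ {e f} → R e → R f → ¬ Compatible Q e f) → ∀ {k} →
                (∀ M → All P M → AllPairs (Compatible Q) M → length M ≤ k) →
                ∀ {M} → All (λ e → P e ⊎ R e) M → AllPairs (Compatible Q) M → length M ≤ suc k
  one-outside conflict bound prs cs with extract conflict prs cs
  ... | inj₁ ps = ℕ.m≤n⇒m≤1+n (bound _ ps cs)
  ... | inj₂ (e , M′ , M↭ , _ , ps) with _ ∷ cs′ ← AllPairs-resp-↭ (Compatible-sym Q) M↭ cs =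
    ℕ.≤-trans (ℕ.≤-reflexive (↭-length M↭)) (s≤s (bound M′ ps cs′))

  at-most-one : ∀ {R : V × V → Set} → (∀ {e f} → R e → R f → ¬ Compatible Q e f) →
                ∀ {M} → All R M → AllPairs (Compatible Q) M → length M ≤ 1
  at-most-one conflict rs = one-outside {P = λ _ → ⊥} conflict
    (λ { [] _ _ → z≤n ; (_ ∷ _) (() ∷ _) _ }) (All.map inj₂ rs)

  empty-left : ∀ {B M} {n} → Matching Q (_∈ []) B M → length M ≤ n
  empty-left ([] , _)             = z≤n
  empty-left ((() , _) ∷ _ , _)

  empty-right : ∀ {A M} {n} → Matching Q A (_∈ []) M → length M ≤ n
  empty-right ([] , _)                 = z≤n
  empty-right ((_ , () , _) ∷ _ , _)

Width : Rel V 0ℓ → List V → ℕ → Set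
Width Q L k = ∀ A B → A ++ B ≡ L → ∀ {M} → Matching Q (_∈ A) (_∈ B) M → length M ≤ k

UB : Rel V 0ℓ → List V → ℕ → Set
UB Q S k = ∃[ L ] L ↭ S × Width Q L k

UB-resp-↭ : ∀ {Q : Rel V 0ℓ} {S S′ k} → S ↭ S′ → UB Q S k → UB Q S′ k
UB-resp-↭ S↭ (L , L↭ , w) = L , ↭-trans L↭ S↭ , w

-- Good x N k bounds the layout x ∷ N by suc k when x may have neighbours anywhere: an edge
-- leaving x can only be matched together with edges avoiding the neighbours of x.
Good : Rel V 0ℓ → V → List V → ℕ → Set
Good Q x N k = ∀ A B → A ++ B ≡ N → ∀ {M} → Matching Q (_∈ A) (_∈ B) M →
               length M ≤ suc k × (All (λ e → ¬ Q x (proj₂ e)) M → length M ≤ k)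

module _ {Q : Rel V 0ℓ} where

  Width-[] : ∀ {k} → Width Q [] k
  Width-[] [] [] refl m = empty-left m

  Width-[x] : ∀ {x k} → Width Q [ x ] k
  Width-[x] []      B _    m = empty-left m
  Width-[x] (_ ∷ []) [] _ m = empty-right m

  confine : ∀ A C {X Y : List V} →
            (∀ {a b} → a ∈ A ++ C → b ∈ Y → ¬ Q a b) → X ≡ A ++ C → ∀ {e} →
            Crossing Q (_∈ A) (_∈ C ++ Y) e → Crossing Q (_∈ A) (_∈ C) e
  confine A C none refl (a∈ , b∈ , q) with ∈-++⁻ C b∈
  ... | inj₁ b∈C = a∈ , b∈C , q
  ... | inj₂ b∈Y = contradiction q (none (∈-++⁺ˡ a∈) b∈Y)

  confineʳ : ∀ X {C B : List V} → (∀ {a b} → a ∈ X → b ∈ C ++ B → ¬ Q a b) → ∀ {e} →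
             Crossing Q (_∈ X ++ C) (_∈ B) e → Crossing Q (_∈ C) (_∈ B) e
  confineʳ X {C} none (a∈ , b∈ , q) with ∈-++⁻ X a∈
  ... | inj₁ a∈X = contradiction q (none a∈X (∈-++⁺ʳ C b∈))
  ... | inj₂ a∈C = a∈C , b∈ , q

  Width-++ : ∀ {X Y k} → Width Q X k → Width Q Y k →
             (∀ {a b} → a ∈ X → b ∈ Y → ¬ Q a b) → Width Q (X ++ Y) k
  Width-++ {X} {Y} wX wY none A B eq m with ++-split A B X Y eq
  ... | inj₁ (C , refl , refl) = wX A C refl (Matching-mapAll (confine A C none refl) m)
  ... | inj₂ (C , refl , refl) = wY C B refl (Matching-mapAll (confineʳ X none) m)

  Good-++ : ∀ {x X Y k} → Good Q x X k → Good Q x Y k →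
            (∀ {a b} → a ∈ X → b ∈ Y → ¬ Q a b) → Good Q x (X ++ Y) k
  Good-++ {x} {X} {Y} gX gY none A B eq m with ++-split A B X Y eq
  ... | inj₁ (C , refl , refl) = gX A C refl (Matching-mapAll (confine A C none refl) m)
  ... | inj₂ (C , refl , refl) = gY C B refl (Matching-mapAll (confineʳ X none) m)

  Good-[] : ∀ {x k} → Good Q x [] k
  Good-[] [] [] refl m = empty-left m , λ _ → empty-left m

  -- With `v` last, every crossing edge that is not inside `W` ends in `v`, so at most one is used.
  -- None is used if the edges avoid the neighbours of `x`, since `v` is one of them.
  Good-block : ∀ {x v W k} → Q x v → Width Q W k → Good Q x (W ++ [ v ]) k
  Good-block {x} {v} {W} {k} xv w A B eq {M} m@(cs , ps) with ∷ʳ-split A B W eq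
  ... | inj₂ refl = empty-right m , λ _ → empty-right m
  ... | inj₁ (C , refl , refl) =
      one-outside {P = Crossing Q (_∈ A) (_∈ C)} {R = λ e → proj₂ e ≡ v × Q (proj₁ e) (proj₂ e)}
        (λ { (refl , q) (refl , _) (¬q , _) → ¬q q })
        (λ _ cs′ ps′ → w A C refl (cs′ , ps′))
        (All.map locate cs) ps
    , λ ns → w A C refl (All.zipWith inside (cs , ns) , ps)
    where
    locate : ∀ {e} → Crossing Q (_∈ A) (_∈ C ++ [ v ]) e →
             Crossing Q (_∈ A) (_∈ C) e ⊎ (proj₂ e ≡ v × Q (proj₁ e) (proj₂ e))
    locate (a∈ , b∈ , q) with ∈-++⁻ C b∈
    ... | inj₁ b∈C        = inj₁ (a∈ , b∈C , q)
    ... | inj₂ (here b≡v) = inj₂ (b≡v , q)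
    inside : ∀ {e} → Crossing Q (_∈ A) (_∈ C ++ [ v ]) e × ¬ Q x (proj₂ e) → Crossing Q (_∈ A) (_∈ C) e
    inside (c , ¬xb) with locate c
    ... | inj₁ c′         = c′
    ... | inj₂ (refl , _) = contradiction xv ¬xb

  -- Z is the layout of the rest of a path through x, so only its first vertex is adjacent to x.
  Width-path : ∀ {x N Z k} → Good Q x N k → Width Q Z (suc k) →
               (∀ {a b} → a ∈ N → b ∈ Z → ¬ Q a b) → (∀ {b} → b ∈ drop 1 Z → ¬ Q x b) →
               Width Q (x ∷ N ++ Z) (suc k)
  Width-path {x} {N} {Z} {k} g wZ none ¬x = width
    where
    early : ∀ A C → A ++ C ≡ N → ∀ {M} → Matching Q (_∈ x ∷ A) (_∈ C ++ Z) M → length M ≤ suc k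
    early A C refl {M} (cs , ps) with extract conflict (All.map locate cs) ps
      where
      P R : V × V → Set
      P = Crossing Q (_∈ A) (_∈ C)
      R e = proj₁ e ≡ x × Q (proj₁ e) (proj₂ e)
      conflict : ∀ {e f} → R e → R f → ¬ Compatible Q e f
      conflict (refl , _) (refl , q) (¬q , _) = ¬q q
      locate : ∀ {e} → Crossing Q (_∈ x ∷ A) (_∈ C ++ Z) e → P e ⊎ R e
      locate (here refl , _ , q) = inj₂ (refl , q)
      locate (there a∈ , b∈ , q) = inj₁ (confine A C none refl (a∈ , b∈ , q))
    ... | inj₁ ins = proj₁ (g A C refl (ins , ps))
    ... | inj₂ (e , M′ , M↭ , (refl , _) , ins)
      with c ∷ ps′ ← AllPairs-resp-↭ (Compatible-sym Q) M↭ ps =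
      ℕ.≤-trans (ℕ.≤-reflexive (↭-length M↭))
        (s≤s (proj₂ (g A C refl (ins , ps′)) (All.map proj₁ c)))
    width : Width Q (x ∷ N ++ Z) (suc k)
    width [] B _ m = empty-left m
    width (a ∷ A) B eq m with refl ← cong head eq
      with ++-split A B N Z (cong (drop 1) eq)
    ... | inj₁ (C , refl , refl)      = early A C refl m
    ... | inj₂ ([] , refl , refl)     = early _ [] (≡.trans (++-identityʳ _) (++-identityʳ _)) m
    -- Once the first vertex of `Z` lies on the left, `x` has no neighbour on the right and the
    -- bound for `Z` takes over.
    ... | inj₂ (c ∷ C , refl , refl) = wZ (c ∷ C) B refl (Matching-mapAll late m)
      where
      late : ∀ {e} → Crossing Q (_∈ x ∷ N ++ c ∷ C) (_∈ B) e → Crossing Q (_∈ c ∷ C) (_∈ B) e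
      late (here refl , b∈ , q) = contradiction q (¬x (∈-++⁺ʳ C b∈))
      late (there a∈ , b∈ , q)  = confineʳ N none (a∈ , b∈ , q)

  -- The edge `c x` is the only link between the two parts. A cut before `c` sees nothing beyond
  -- `c`, a cut after `x` sees nothing before `x`, and the cut between them is crossed by that
  -- single edge.
  Width-join : ∀ {X c x N k} → Width Q (X ++ [ c ]) (suc k) → Width Q (x ∷ N) (suc k) →
               (∀ {a b} → a ∈ X → b ∈ x ∷ N → ¬ Q a b) → (∀ {b} → b ∈ N → ¬ Q c b) →
               Width Q (X ++ c ∷ x ∷ N) (suc k)
  Width-join {X} {c} {x} {N} {k} wX wN none ¬c = width
    where
    early : ∀ A C → A ++ C ≡ X → ∀ {M} → Matching Q (_∈ A) (_∈ C ++ c ∷ x ∷ N) M → length M ≤ suc k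
    early A C refl m = wX A (C ++ [ c ]) (≡.sym (++-assoc A C [ c ])) (Matching-mapAll f m)
      where
      f : ∀ {e} → Crossing Q (_∈ A) (_∈ C ++ c ∷ x ∷ N) e → Crossing Q (_∈ A) (_∈ C ++ [ c ]) e
      f (a∈ , b∈ , q) with ∈-++⁻ C b∈
      ... | inj₁ b∈C         = a∈ , ∈-++⁺ˡ b∈C , q
      ... | inj₂ (here refl) = a∈ , ∈-++⁺ʳ C (here refl) , q
      ... | inj₂ (there b∈N) = contradiction q (none (∈-++⁺ˡ a∈) b∈N)
    width : Width Q (X ++ c ∷ x ∷ N) (suc k)
    width A B eq m with ++-split A B X (c ∷ x ∷ N) eq
    ... | inj₁ (C , refl , refl) = early A C refl m
    ... | inj₂ ([] , refl , refl) rewrite ++-identityʳ X = early X [] (++-identityʳ X) m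
    ... | inj₂ (c ∷ [] , refl , refl) =
      ℕ.≤-trans (at-most-one (λ { (refl , refl , q) (refl , refl , _) (¬q , _) → ¬q q })
        (All.map middle (proj₁ m)) (proj₂ m)) (s≤s z≤n)
      where
      middle : ∀ {e} → Crossing Q (_∈ X ++ [ c ]) (_∈ x ∷ N) e →
               proj₁ e ≡ c × proj₂ e ≡ x × Q (proj₁ e) (proj₂ e)
      middle (a∈ , b∈ , q) with ∈-++⁻ X a∈ | b∈
      ... | inj₁ a∈X         | _          = contradiction q (none a∈X b∈)
      ... | inj₂ (here refl) | here refl  = refl , refl , q
      ... | inj₂ (here refl) | there b∈N = contradiction q (¬c b∈N)
    ... | inj₂ (c ∷ x ∷ C , refl , refl) = wN (x ∷ C) B refl (Matching-mapAll late m)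
      where
      late : ∀ {e} → Crossing Q (_∈ X ++ c ∷ x ∷ C) (_∈ B) e → Crossing Q (_∈ x ∷ C) (_∈ B) e
      late (a∈ , b∈ , q) with ∈-++⁻ X a∈
      ... | inj₁ a∈X         = contradiction q (none a∈X (there (∈-++⁺ʳ C b∈)))
      ... | inj₂ (here refl) = contradiction q (¬c (∈-++⁺ʳ C b∈))
      ... | inj₂ (there a∈C) = a∈C , b∈ , q

  Width-reverse : ∀ {L k} → Symmetric Q → Width Q L k → Width Q (reverse L) k
  Width-reverse {L} {k} Q-sym w A B eq {M} (cs , ps) =
    subst (_≤ k) (length-map Prod.swap M) (w (reverse B) (reverse A) eq′
      ( Allₚ.map⁺ (All.map (λ (a∈ , b∈ , q) → Anyₚ.reverse⁺ b∈ , Anyₚ.reverse⁺ a∈ , Q-sym q) cs)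
      , AllPairsₚ.map⁺ (AllPairs.map (λ (p , q) → q ∘ Q-sym , p ∘ Q-sym) ps)))
    where
    eq′ : reverse B ++ reverse A ≡ L
    eq′ = ≡.trans (≡.sym (reverse-++ A B)) (≡.trans (cong reverse eq) (reverse-involutive L))

-- Lower bounds and labelled trees

-- Every ordering has a cut, placed just after a vertex of W, crossed by an induced matching
-- of size k inside S.
LB : Rel V 0ℓ → (W S : List V) → ℕ → Set
LB {V} Q W S k = ∀ (pos : V → ℕ) → (∀ {a b} → pos a ≡ pos b → a ≡ b) →
  ∃[ w ] w ∈ W × ∃[ M ] length M ≡ k ×
    Matching Q (λ a → a ∈ S × pos a ≤ pos w) (λ b → b ∈ S × pos w < pos b) M

LB-mono : ∀ {Q : Rel V 0ℓ} {W W′ S S′ k} → (∀ {a} → a ∈ W → a ∈ W′) → (∀ {a} → a ∈ S → a ∈ S′) →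
          LB Q W S k → LB Q W′ S′ k
LB-mono W⊆ S⊆ lb pos inj with lb pos inj
... | w , w∈ , M , eq , m = w , W⊆ w∈ , M , eq ,
  Matching-mapAll (λ ((a∈ , a≤) , (b∈ , <b) , q) → (S⊆ a∈ , a≤) , (S⊆ b∈ , <b) , q) m

LB-0 : ∀ {Q : Rel V 0ℓ} {w W S} → w ∈ W → LB Q W S 0
LB-0 {w = w} w∈ pos inj = w , w∈ , [] , refl , [] , []

Chain : Rel V 0ℓ → (V → Set) → Rel V 0ℓ
Chain Q P = Star (λ a b → P a × P b × Q a b)

Chain-reverse : ∀ {Q : Rel V 0ℓ} {P} → Symmetric Q → Symmetric (Chain Q P)
Chain-reverse Q-sym = Star.reverse (λ (p , q , r) → q , p , Q-sym r)

Chain-crosses : ∀ {Q : Rel V 0ℓ} {P} (pos : V → ℕ) t {a b} → Chain Q P a b → pos a ≤ t → t < pos b →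
                ∃₂ λ u v → P u × P v × Q u v × pos u ≤ t × t < pos v
Chain-crosses pos t ε a≤t t<a = contradiction t<a (ℕ.≤⇒≯ a≤t)
Chain-crosses pos t (_◅_ {j = j} (pa , pj , q) c) a≤t t<b with pos j ℕ.≤? t
... | yes j≤t = Chain-crosses pos t c j≤t t<b
... | no  j≰t = _ , _ , pa , pj , q , a≤t , ℕ.≰⇒> j≰t

-- For symmetric `Q`, an edge joining two such vertices is compatible with every edge inside `F`.
Far : Rel V 0ℓ → (S F : List V) → V → Set
Far Q S F z = z ∈ S × (∀ {s} → s ∈ F → ¬ Q z s)

-- The cut of the middle one of the three separates the other two.
LB-three : ∀ {Q : Rel V 0ℓ} {S : List V} (W F : Fin 3 → List V) {k} → Symmetric Q →
           (∀ i {a} → a ∈ W i → a ∈ S) → (∀ i {a} → a ∈ F i → a ∈ S) →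
           (∀ {i j} → i ≢ j → ∀ {a b} → a ∈ W i → b ∈ W j → a ≢ b) →
           (∀ {i j l} → i ≢ j → i ≢ l → j ≢ l → ∀ {a b} → a ∈ W i → b ∈ W j →
             Chain Q (Far Q S (F l)) a b) →
           (∀ i → LB Q (W i) (F i) k) → LB Q S S (suc k)
LB-three {V} {Q} {S} W F {k} Q-sym W⊆ F⊆ disj link lb pos inj = sort
  where
  w : Fin 3 → V
  w i = proj₁ (lb i pos inj)
  w∈ : ∀ i → w i ∈ W i
  w∈ i = proj₁ (proj₂ (lb i pos inj))

  Result : Set
  Result = ∃[ w ] w ∈ S × ∃[ M ] length M ≡ suc k ×
    Matching Q (λ a → a ∈ S × pos a ≤ pos w) (λ b → b ∈ S × pos w < pos b) M

  middle : ∀ {i l j} → i ≢ j → i ≢ l → j ≢ l → pos (w i) < pos (w l) → pos (w l) < pos (w j) → Result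
  middle {i} {l} {j} i≢j i≢l j≢l i<l l<j
    with M , eq , cs , ps ← proj₂ (proj₂ (lb l pos inj))
    with u , v , (u∈ , ¬u) , (v∈ , ¬v) , q , u≤ , <v ←
      Chain-crosses pos (pos (w l)) (link i≢j i≢l j≢l (w∈ i) (w∈ j)) (ℕ.<⇒≤ i<l) l<j =
    w l , W⊆ l (w∈ l) , (u , v) ∷ M , cong suc eq ,
    ((u∈ , u≤) , (v∈ , <v) , q) ∷
      All.map (λ ((a∈ , a≤) , (b∈ , <b) , q) → (F⊆ l a∈ , a≤) , (F⊆ l b∈ , <b) , q) cs ,
    All.map (λ ((a∈ , _) , (b∈ , _) , _) → ¬u b∈ , ¬v a∈ ∘ Q-sym) cs ∷ ps

  distinct : ∀ {i j} → i ≢ j → pos (w i) ≢ pos (w j)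
  distinct {i} {j} i≢j eq = disj i≢j (w∈ i) (w∈ j) (inj eq)

  sort : Result
  sort with ℕ.<-cmp (pos (w zero)) (pos (w (suc zero)))
          | ℕ.<-cmp (pos (w (suc zero))) (pos (w (suc (suc zero))))
          | ℕ.<-cmp (pos (w zero)) (pos (w (suc (suc zero))))
  ... | tri≈ _ eq _ | _           | _           = contradiction eq (distinct λ ())
  ... | _           | tri≈ _ eq _ | _           = contradiction eq (distinct λ ())
  ... | _           | _           | tri≈ _ eq _ = contradiction eq (distinct λ ())
  ... | tri< p _ _  | tri< q _ _  | _           = middle (λ ()) (λ ()) (λ ()) p q
  ... | tri> _ _ p  | tri> _ _ q  | _           = middle (λ ()) (λ ()) (λ ()) q p
  ... | tri< p _ _  | tri> _ _ q  | tri< r _ _  = middle (λ ()) (λ ()) (λ ()) r q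
  ... | tri< p _ _  | tri> _ _ q  | tri> _ _ r  = middle (λ ()) (λ ()) (λ ()) r p
  ... | tri> _ _ p  | tri< q _ _  | tri< r _ _  = middle (λ ()) (λ ()) (λ ()) p r
  ... | tri> _ _ p  | tri< q _ _  | tri> _ _ r  = middle (λ ()) (λ ()) (λ ()) q r

-- Rooted trees, their squares, rerooting, and branching vertices

data Rose (V : Set) : Set where
  node : V → List (Rose V) → Rose V

root : Rose V → V
root (node x _) = x

children : Rose V → List (Rose V)
children (node _ cs) = cs

flat  : Rose V → List V
flats : List (Rose V) → List V
flat (node x cs) = x ∷ flats cs
flats []       = []
flats (c ∷ cs) = flat c ++ flats cs

Rose-ind : ∀ {P : Rose V → Set} → (∀ x cs → All P cs → P (node x cs)) → ∀ t → P t
Rose-inds : ∀ {P : Rose V → Set} → (∀ x cs → All P cs → P (node x cs)) → ∀ ts → All P ts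
Rose-ind  f (node x cs) = f x cs (Rose-inds f cs)
Rose-inds f []       = []
Rose-inds f (t ∷ ts) = Rose-ind f t ∷ Rose-inds f ts

root∈flat : ∀ (t : Rose V) → root t ∈ flat t
root∈flat (node _ _) = here refl

flats⊆flat : ∀ (t : Rose V) {z} → z ∈ flats (children t) → z ∈ flat t
flats⊆flat (node _ _) = there

∈-flats⁻ : ∀ (cs : List (Rose V)) {z} → z ∈ flats cs → ∃[ c ] c ∈ cs × z ∈ flat c
∈-flats⁻ (c ∷ cs) z∈ with ∈-++⁻ (flat c) z∈
... | inj₁ z∈c  = c , here refl , z∈c
... | inj₂ z∈cs with d , d∈ , z∈d ← ∈-flats⁻ cs z∈cs = d , there d∈ , z∈d

∈-flats⁺ : ∀ {cs : List (Rose V)} {c z} → c ∈ cs → z ∈ flat c → z ∈ flats cs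
∈-flats⁺ (here refl)            z∈ = ∈-++⁺ˡ z∈
∈-flats⁺ {cs = d ∷ _} (there c∈) z∈ = ∈-++⁺ʳ (flat d) (∈-flats⁺ c∈ z∈)

flats-↭ : ∀ {cs ds : List (Rose V)} → cs ↭ ds → flats cs ↭ flats ds
flats-↭ refl            = ↭-refl
flats-↭ (prep c p)      = ++⁺ˡ (flat c) (flats-↭ p)
flats-↭ (swap c d p)    = ↭-trans (shifts (flat c) (flat d)) (++⁺ˡ (flat d) (++⁺ˡ (flat c) (flats-↭ p)))
flats-↭ (trans p q)     = ↭-trans (flats-↭ p) (flats-↭ q)

Apart : Rel V 0ℓ → Rel (Rose V) 0ℓ
Apart E c d = ∀ {a b} → a ∈ flat c → b ∈ flat d → a ≢ b × ¬ E a b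

ChildOf : Rel V 0ℓ → V → Rose V → Set
ChildOf E x c = E x (root c) × (∀ {z} → z ∈ flat c → E x z → z ≡ root c) × x ∉ flat c

-- The labels of t are pairwise distinct and E restricted to them is exactly the edge set of t.
data Valid (E : Rel V 0ℓ) : Rose V → Set where
  valid : ∀ {x cs} → All (ChildOf E x) cs → AllPairs (Apart E) cs → All (Valid E) cs → Valid E (node x cs)

-- Only midpoints of paths with two edges are asked for: this makes the square of the ambient graph,
-- restricted to `S`, agree with the square of the part inside `S`.
Convex : Rel V 0ℓ → List V → Set
Convex E S = ∀ {a b c} → a ∈ S → b ∈ S → a ≢ b → E a c → E c b → c ∈ S

Convex-resp-↭ : ∀ {E : Rel V 0ℓ} {S S′} → S ↭ S′ → Convex E S → Convex E S′
Convex-resp-↭ p conv a∈ b∈ a≢b e f =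
  ∈-resp-↭ p (conv (∈-resp-↭ (↭-sym p) a∈) (∈-resp-↭ (↭-sym p) b∈) a≢b e f)

E² : Rel V 0ℓ → Rel V 0ℓ
E² E u v = u ≢ v × (E u v ⊎ ∃[ c ] E u c × E c v)

AllPairs-lookup : ∀ {A : Set} {R : Rel A 0ℓ} → Symmetric R → ∀ {xs x y} → AllPairs R xs →
                  x ∈ xs → y ∈ xs → x ≡ y ⊎ R x y
AllPairs-lookup R-sym (_ ∷ _)  (here refl) (here refl) = inj₁ refl
AllPairs-lookup R-sym (r ∷ _)  (here refl) (there y∈)  = inj₂ (All.lookup r y∈)
AllPairs-lookup R-sym (r ∷ _)  (there x∈)  (here refl) = inj₂ (R-sym (All.lookup r x∈))
AllPairs-lookup R-sym (_ ∷ rs) (there x∈)  (there y∈)  = AllPairs-lookup R-sym rs x∈ y∈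

module Tree {E : Rel V 0ℓ} (E-sym : Symmetric E) (E-irrefl : ∀ {x} → ¬ E x x) where

  Apart-sym : Symmetric (Apart E)
  Apart-sym ap b∈ a∈ with a≢b , ¬e ← ap a∈ b∈ = a≢b ∘ ≡.sym , ¬e ∘ E-sym

  E²-sym : Symmetric (E² E)
  E²-sym (u≢v , inj₁ e)           = u≢v ∘ ≡.sym , inj₁ (E-sym e)
  E²-sym (u≢v , inj₂ (c , e , f)) = u≢v ∘ ≡.sym , inj₂ (c , E-sym f , E-sym e)

  E⊆E² : ∀ {u v} → E u v → E² E u v
  E⊆E² e = (λ { refl → E-irrefl e }) , inj₁ e

  Valid-child : ∀ {x cs c} → Valid E (node x cs) → c ∈ cs → Valid E c
  Valid-child (valid _ _ vs) = All.lookup vs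

  Valid-ChildOf : ∀ {x cs c} → Valid E (node x cs) → c ∈ cs → ChildOf E x c
  Valid-ChildOf (valid cs _ _) = All.lookup cs

  root∉flats : ∀ {t} → Valid E t → root t ∉ flats (children t)
  root∉flats {node x cs} (valid ch _ _) x∈ with c , c∈ , x∈c ← ∈-flats⁻ cs x∈ =
    proj₂ (proj₂ (All.lookup ch c∈)) x∈c

  Valid-resp-↭ : ∀ {x cs ds} → cs ↭ ds → Valid E (node x cs) → Valid E (node x ds)
  Valid-resp-↭ p (valid ch ap vs) =
    valid (All-resp-↭ p ch) (AllPairs-resp-↭ Apart-sym p ap) (All-resp-↭ p vs)

  Valid-tail : ∀ {x c cs} → Valid E (node x (c ∷ cs)) → Valid E (node x cs)
  Valid-tail (valid (_ ∷ ch) (_ ∷ ap) (_ ∷ vs)) = valid ch ap vs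

  Apart-flats : ∀ {c cs} → All (Apart E c) cs → ∀ {a b} → a ∈ flat c → b ∈ flats cs → a ≢ b × ¬ E a b
  Apart-flats {c = node v ds} {cs} ap a∈ b∈ with d , d∈ , b∈d ← ∈-flats⁻ cs b∈ = All.lookup ap d∈ a∈ b∈d

  Valid⇒Unique : ∀ {t} → Valid E t → Unique (flat t)
  Valids⇒Unique : ∀ {cs} → AllPairs (Apart E) cs → All (Valid E) cs → Unique (flats cs)
  Valid⇒Unique {node x cs} v@(valid _ ap vs) =
    All.tabulate (λ { z∈ refl → root∉flats v z∈ }) ∷ Valids⇒Unique ap vs
  Valids⇒Unique [] [] = []
  Valids⇒Unique (a ∷ ap) (v ∷ vs) = AllPairsₚ.++⁺ (Valid⇒Unique v) (Valids⇒Unique ap vs)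
    (All.tabulate λ y∈ → All.tabulate λ z∈ → proj₁ (Apart-flats a y∈ z∈))

  -- A midpoint outside `c` would be `x`, whose only neighbour in `c` is the root, so that both ends
  -- coincide, or would lie in a sibling subtree, which has no edge to `c`.
  Convex-child : ∀ {x cs c} → Valid E (node x cs) → Convex E (flat (node x cs)) → c ∈ cs → Convex E (flat c)
  Convex-child {x} {cs} {c} (valid ch ap _) conv c∈ {a} {b} a∈ b∈ a≢b e f
    with conv (there (∈-flats⁺ c∈ a∈)) (there (∈-flats⁺ c∈ b∈)) a≢b e f
  ... | here refl = contradiction (≡.trans (only a∈ (E-sym e)) (≡.sym (only b∈ f))) a≢b
    where only = proj₁ (proj₂ (All.lookup ch c∈))
  ... | there m∈ with d , d∈ , m∈d ← ∈-flats⁻ cs m∈ with AllPairs-lookup Apart-sym ap c∈ d∈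
  ...   | inj₁ refl = m∈d
  ...   | inj₂ apart = contradiction e (proj₂ (apart a∈ m∈d))

  -- A path of two edges between sibling subtrees has to pass through `x`, and `x` meets each of
  -- them in its root only.
  E²-between : ∀ {x cs c d} → Valid E (node x cs) → Convex E (flat (node x cs)) → c ∈ cs → d ∈ cs →
               Apart E c d → ∀ {a b} → a ∈ flat c → b ∈ flat d → E² E a b → a ≡ root c × b ≡ root d
  E²-between v conv c∈ d∈ apart a∈ b∈ (_ , inj₁ e) = contradiction e (proj₂ (apart a∈ b∈))
  E²-between {x} {cs} {c} {d} (valid ch ap _) conv c∈ d∈ apart a∈ b∈ (a≢b , inj₂ (m , e , f))
    with conv (there (∈-flats⁺ c∈ a∈)) (there (∈-flats⁺ d∈ b∈)) a≢b e f
  ... | here refl = proj₁ (proj₂ (All.lookup ch c∈)) a∈ (E-sym e) , proj₁ (proj₂ (All.lookup ch d∈)) b∈ f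
  ... | there m∈ with g , g∈ , m∈g ← ∈-flats⁻ cs m∈ with AllPairs-lookup Apart-sym ap c∈ g∈
  ...   | inj₂ c∥g = contradiction e (proj₂ (c∥g a∈ m∈g))
  ...   | inj₁ refl = contradiction f (proj₂ (apart m∈g b∈))

  Valid-reroot : ∀ {e v ds cs} → Valid E (node e (node v ds ∷ cs)) → Valid E (node v (node e cs ∷ ds))
  Valid-reroot {e} {v} {ds} {cs} (valid ((ev , only , e∉) ∷ ch) (ap ∷ aps) (valid ch′ aps′ vs′ ∷ vs)) =
    valid ((E-sym ev , only-e , v∉) ∷ ch′) (All.tabulate (λ d∈ → apart d∈) ∷ aps′) (valid ch aps vs ∷ vs′)
    where
    only-e : ∀ {z} → z ∈ flat (node e cs) → E v z → z ≡ e
    only-e (here z≡e) _ = z≡e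
    only-e (there z∈) f = contradiction f (proj₂ (Apart-flats {c = node v ds} {cs} ap (here refl) z∈))
    v∉ : v ∉ flat (node e cs)
    v∉ (here refl) = e∉ (here refl)
    v∉ (there v∈)  = proj₁ (Apart-flats {c = node v ds} {cs} ap (here refl) v∈) refl
    apart : ∀ {d} → d ∈ ds → Apart E (node e cs) d
    apart d∈ (here refl) b∈ =
      (λ { refl → e∉ (there (∈-flats⁺ d∈ b∈)) }) ,
      λ f → proj₂ (proj₂ (All.lookup ch′ d∈)) (subst (_∈ _) (only (there (∈-flats⁺ d∈ b∈)) f) b∈)
    apart d∈ (there a∈) b∈ with ne , ¬f ← Apart-flats {c = node v ds} {cs} ap (there (∈-flats⁺ d∈ b∈)) a∈ =
      ne ∘ ≡.sym , ¬f ∘ E-sym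

  flat-reroot : ∀ (e v : V) ds cs → flat (node e (node v ds ∷ cs)) ↭ flat (node v (node e cs ∷ ds))
  flat-reroot e v ds cs = swap e v (++-comm (flats ds) (flats cs))

  root-Chain : ∀ {Q : Rel V 0ℓ} {P} → (∀ {u v} → E u v → Q u v) → ∀ t → Valid E t →
               (∀ {z} → z ∈ flat t → P z) → ∀ {z} → z ∈ flat t → Chain Q P (root t) z
  root-Chain {Q} {P} E⊆Q = Rose-ind step
    where
    step : ∀ x cs → All (λ c → Valid E c → (∀ {z} → z ∈ flat c → P z) → ∀ {z} → z ∈ flat c → Chain Q P (root c) z) cs →
           Valid E (node x cs) → (∀ {z} → z ∈ x ∷ flats cs → P z) → ∀ {z} → z ∈ x ∷ flats cs → Chain Q P x z
    step x cs ih v p (here refl) = ε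
    step x cs ih v p (there z∈) with c , c∈ , z∈c ← ∈-flats⁻ cs z∈ =
      (p (here refl) , p (there (∈-flats⁺ c∈ (root∈flat c))) , E⊆Q (proj₁ (Valid-ChildOf v c∈))) ◅
      All.lookup ih c∈ (Valid-child v c∈) (p ∘ there ∘ ∈-flats⁺ c∈) z∈c

  -- The chain between two subtrees uses the square edge joining their roots, so it bypasses `x`.
  -- The conclusion therefore avoids `x` and has the form required of a subtree when the
  -- construction is applied one level higher.
  LB²-branch : ∀ {x cs k} (c : Fin 3 → Rose V) → Valid E (node x cs) → Convex E (flat (node x cs)) →
               (∀ i → c i ∈ cs) → (∀ {i j} → i ≢ j → Apart E (c i) (c j)) →
               (∀ i → LB (E² E) (flat (c i)) (flats (children (c i))) k) →
               LB (E² E) (flats cs) (flats cs) (suc k)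
  LB²-branch {x} {cs} c v conv c∈ apart =
    LB-three (flat ∘ c) (flats ∘ children ∘ c) E²-sym
      (λ i → ∈-flats⁺ (c∈ i)) (λ i → ∈-flats⁺ (c∈ i) ∘ flats⊆flat (c i))
      (λ i≢j a∈ b∈ → proj₁ (apart i≢j a∈ b∈))
      link
    where
    far : ∀ {i l} → i ≢ l → ∀ {z} → z ∈ flat (c i) → Far (E² E) (flats cs) (flats (children (c l))) z
    far {i} {l} i≢l z∈ = ∈-flats⁺ (c∈ i) z∈ , λ s∈ q →
      root∉flats (Valid-child v (c∈ l)) (subst (_∈ _)
        (proj₂ (E²-between v conv (c∈ i) (c∈ l) (apart i≢l) z∈ (flats⊆flat (c l) s∈) q)) s∈)
    link : ∀ {i j l} → i ≢ j → i ≢ l → j ≢ l → ∀ {a b} → a ∈ flat (c i) → b ∈ flat (c j) →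
           Chain (E² E) (Far (E² E) (flats cs) (flats (children (c l)))) a b
    link {i} {j} i≢j i≢l j≢l a∈ b∈ =
      Chain-reverse E²-sym (root-Chain E⊆E² (c i) (Valid-child v (c∈ i)) (far i≢l) a∈) ◅◅
      ((far i≢l (root∈flat (c i)) , far j≢l (root∈flat (c j)) ,
        proj₁ (apart i≢j (root∈flat (c i)) (root∈flat (c j))) ,
        inj₂ (x , E-sym (proj₁ (Valid-ChildOf v (c∈ i))) , proj₁ (Valid-ChildOf v (c∈ j)))) ◅
      root-Chain E⊆E² (c j) (Valid-child v (c∈ j)) (far j≢l) b∈)

  -- In the tree itself the chain has to run through `x`, so `x` may occur in the matching. Before
  -- the next application the result must be hung below a fresh vertex.
  LB-branch : ∀ {x cs k} (c : Fin 3 → Rose V) → Valid E (node x cs) →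
              (∀ i → c i ∈ cs) → (∀ {i j} → i ≢ j → Apart E (c i) (c j)) →
              (∀ i → LB E (flat (c i)) (flats (children (c i))) k) →
              LB E (flat (node x cs)) (flat (node x cs)) (suc k)
  LB-branch {x} {cs} c v c∈ apart =
    LB-three (flat ∘ c) (flats ∘ children ∘ c) E-sym
      (λ i → there ∘ ∈-flats⁺ (c∈ i)) (λ i → there ∘ ∈-flats⁺ (c∈ i) ∘ flats⊆flat (c i))
      (λ i≢j a∈ b∈ → proj₁ (apart i≢j a∈ b∈))
      link
    where
    far : ∀ {i l} → i ≢ l → ∀ {z} → z ∈ flat (c i) → Far E (flat (node x cs)) (flats (children (c l))) z
    far {i} {l} i≢l z∈ = there (∈-flats⁺ (c∈ i) z∈) , λ s∈ → proj₂ (apart i≢l z∈ (flats⊆flat (c l) s∈))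
    far-x : ∀ l → Far E (flat (node x cs)) (flats (children (c l))) x
    far-x l = here refl , λ s∈ e → root∉flats (Valid-child v (c∈ l))
      (subst (_∈ _) (proj₁ (proj₂ (Valid-ChildOf v (c∈ l))) (flats⊆flat (c l) s∈) e) s∈)
    link : ∀ {i j l} → i ≢ j → i ≢ l → j ≢ l → ∀ {a b} → a ∈ flat (c i) → b ∈ flat (c j) →
           Chain E (Far E (flat (node x cs)) (flats (children (c l)))) a b
    link {i} {j} {l} i≢j i≢l j≢l a∈ b∈ =
      Chain-reverse E-sym (root-Chain id (c i) (Valid-child v (c∈ i)) (far i≢l) a∈) ◅◅
      ((far i≢l (root∈flat (c i)) , far-x l , E-sym (proj₁ (Valid-ChildOf v (c∈ i)))) ◅
      (far-x l , far j≢l (root∈flat (c j)) , proj₁ (Valid-ChildOf v (c∈ j))) ◅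
      root-Chain id (c j) (Valid-child v (c∈ j)) (far j≢l) b∈)

-- Layouts of trees

triple : ∀ {A : Set} → A → A → A → Fin 3 → A
triple a b c zero             = a
triple a b c (suc zero)       = b
triple a b c (suc (suc zero)) = c

triple-all : ∀ {A : Set} {P : A → Set} {a b c} → P a → P b → P c → ∀ i → P (triple a b c i)
triple-all p q r zero             = p
triple-all p q r (suc zero)       = q
triple-all p q r (suc (suc zero)) = r

triple-pairs : ∀ {A : Set} {R : Rel A 0ℓ} → Symmetric R → ∀ {a b c} → R a b → R a c → R b c →
               ∀ i j → i ≢ j → R (triple a b c i) (triple a b c j)
triple-pairs R-sym p q r zero             zero             ne = contradiction refl ne
triple-pairs R-sym p q r zero             (suc zero)       _  = p
triple-pairs R-sym p q r zero             (suc (suc zero)) _  = q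
triple-pairs R-sym p q r (suc zero)       zero             _  = R-sym p
triple-pairs R-sym p q r (suc zero)       (suc zero)       ne = contradiction refl ne
triple-pairs R-sym p q r (suc zero)       (suc (suc zero)) _  = r
triple-pairs R-sym p q r (suc (suc zero)) zero             _  = R-sym q
triple-pairs R-sym p q r (suc (suc zero)) (suc zero)       _  = R-sym r
triple-pairs R-sym p q r (suc (suc zero)) (suc (suc zero)) ne = contradiction refl ne

module Layouts {E : Rel V 0ℓ} (E-sym : Symmetric E) (E-irrefl : ∀ {x} → ¬ E x x) where
  open Tree {E = E} E-sym (λ {x} → E-irrefl {x})

  Light : ℕ → Rose V → Set
  Light m c = All (λ d → UB E (flat d) m) (children c)

  UB-flats : ∀ {ds m} → AllPairs (Apart E) ds → All (λ d → UB E (flat d) m) ds → UB E (flats ds) m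
  UB-flats [] [] = [] , ↭-refl , Width-[]
  UB-flats {d ∷ ds} (ap ∷ aps) ((L , L↭ , w) ∷ us) with L′ , L′↭ , w′ ← UB-flats aps us =
    L ++ L′ , ++⁺ L↭ L′↭ , Width-++ w w′ λ a∈ b∈ →
      proj₂ (Apart-flats {c = d} {ds} ap (∈-resp-↭ L↭ a∈) (∈-resp-↭ L′↭ b∈))

  Good-flats : ∀ {x cs m} → Valid E (node x cs) → All (Light m) cs → ∃[ N ] N ↭ flats cs × Good E x N m
  Good-flats {cs = []} v [] = [] , ↭-refl , Good-[]
  Good-flats {cs = c@(node y ds) ∷ cs} v@(valid ((xy , _) ∷ _) (ap ∷ _) (valid _ aps _ ∷ _)) (l ∷ ls)
    with W , W↭ , w ← UB-flats aps l
    with N , N↭ , g ← Good-flats (Valid-tail v) ls =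
    (W ++ [ y ]) ++ N , ++⁺ block N↭ , Good-++ (Good-block xy w) g λ a∈ b∈ →
      proj₂ (Apart-flats {c = c} {cs} ap (∈-resp-↭ block a∈) (∈-resp-↭ N↭ b∈))
    where
    block : W ++ [ y ] ↭ y ∷ flats ds
    block = ↭-trans (++-comm W [ y ]) (prep y W↭)

  -- Starting with the root is what lets the layout be continued: a parent put in front of it is
  -- adjacent to no later vertex of it.
  RootedUB : Rose V → ℕ → Set
  RootedUB t k = ∃[ N ] (root t ∷ N) ↭ flat t × Width E (root t ∷ N) k

  RootedUB⇒UB : ∀ t {k} → RootedUB t k → UB E (flat t) k
  RootedUB⇒UB t (N , p , w) = root t ∷ N , p , w

  RootedUB-resp-↭ : ∀ {x cs ds k} → cs ↭ ds → RootedUB (node x cs) k → RootedUB (node x ds) k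
  RootedUB-resp-↭ p (N , q , w) = N , ↭-trans q (prep _ (flats-↭ p)) , w

  RootedUB-star : ∀ {x cs m} → Valid E (node x cs) → All (Light m) cs → RootedUB (node x cs) (suc m)
  RootedUB-star {x} v ls with N , N↭ , g ← Good-flats v ls =
    N , prep x N↭ , subst (λ L → Width E (x ∷ L) _) (++-identityʳ N)
      (Width-path g Width-[] (λ _ ()) (λ ()))

  RootedUB-path : ∀ {x c cs m} → Valid E (node x (c ∷ cs)) → All (Light m) cs → RootedUB c (suc m) →
                  RootedUB (node x (c ∷ cs)) (suc m)
  RootedUB-path {x} {c@(node _ ds)} {cs} v@(valid ((xc , only , _) ∷ _) (ap ∷ _) (vc ∷ _)) ls (Z , Z↭ , w)
    with N , N↭ , g ← Good-flats (Valid-tail v) ls =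
    N ++ root c ∷ Z , prep x (↭-trans (++-comm N (root c ∷ Z)) (++⁺ Z↭ N↭)) , Width-path g w
      (λ a∈ b∈ e → proj₂ (Apart-flats {c = c} {cs} ap (∈-resp-↭ Z↭ b∈) (∈-resp-↭ N↭ a∈)) (E-sym e))
      λ b∈ e → root∉flats vc (subst (_∈ flats ds) (only (∈-resp-↭ Z↭ (there b∈)) e) (∈-resp-↭ (drop-∷ Z↭) b∈))

  -- The layout of `c` is reversed so that its root ends up next to `x`.
  UB-join : ∀ {x c cs m} → Valid E (node x (c ∷ cs)) → RootedUB c (suc m) → RootedUB (node x cs) (suc m) →
            UB E (flat (node x (c ∷ cs))) (suc m)
  UB-join {x} {c@(node y ds)} {cs} v@(valid ((xy , only , _) ∷ _) (ap ∷ _) (vc ∷ _)) (Z , Z↭ , wZ) (N , N↭ , wN) =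
    reverse Z ++ y ∷ x ∷ N , perm ,
    Width-join (subst (λ L → Width E L _) (unfold-reverse y Z) (Width-reverse E-sym wZ)) wN none
      (λ b∈ → proj₂ (Apart-flats {c = c} {cs} ap (here refl) (∈-resp-↭ N↭′ b∈)))
    where
    open PermutationReasoning
    N↭′ : N ↭ flats cs
    N↭′ = drop-∷ N↭
    Z↭′ : reverse Z ↭ flats ds
    Z↭′ = ↭-trans (↭-reverse Z) (drop-∷ Z↭)
    perm : reverse Z ++ y ∷ x ∷ N ↭ x ∷ (y ∷ flats ds) ++ flats cs
    perm = begin
      reverse Z ++ y ∷ x ∷ N      ↭⟨ shift y (reverse Z) (x ∷ N) ⟩
      y ∷ reverse Z ++ x ∷ N      ↭⟨ prep y (shift x (reverse Z) N) ⟩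
      y ∷ x ∷ reverse Z ++ N      ↭⟨ swap y x (++⁺ Z↭′ N↭′) ⟩
      x ∷ y ∷ flats ds ++ flats cs ∎
    none : ∀ {a b} → a ∈ reverse Z → b ∈ x ∷ N → ¬ E a b
    none a∈ (here refl) e =
      root∉flats vc (subst (_∈ flats ds) (only (there (∈-resp-↭ Z↭′ a∈)) (E-sym e)) (∈-resp-↭ Z↭′ a∈))
    none a∈ (there b∈) = proj₂ (Apart-flats {c = c} {cs} ap (there (∈-resp-↭ Z↭′ a∈)) (∈-resp-↭ N↭′ b∈))

  -- The dichotomy: a narrow layout of the tree or a wide cut of the square

  Valid-suffix : ∀ {x} cs {ds} → Valid E (node x (cs ++ ds)) → Valid E (node x ds)
  Valid-suffix []       v = v
  Valid-suffix (_ ∷ cs) v = Valid-suffix cs (Valid-tail v)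

  -- A positive witness and not the negation of `Light`; the dichotomy one level below supplies one
  -- or the other.
  Heavy : ℕ → Rose V → Set
  Heavy m c = LB (E² E) (flat c) (flats (children c)) (suc m)

  Dichotomy : ℕ → Set
  Dichotomy m = ∀ t → Valid E t → Convex E (flat t) → UB E (flat t) m ⊎ LB (E² E) (flat t) (flat t) (suc m)

  LB²-triple : ∀ {x c₁ c₂ c₃ cs k} → Valid E (node x (c₁ ∷ c₂ ∷ c₃ ∷ cs)) →
               Convex E (flat (node x (c₁ ∷ c₂ ∷ c₃ ∷ cs))) → LB (E² E) (flat c₁) (flats (children c₁)) k →
               LB (E² E) (flat c₂) (flats (children c₂)) k → LB (E² E) (flat c₃) (flats (children c₃)) k →
               LB (E² E) (flats (c₁ ∷ c₂ ∷ c₃ ∷ cs)) (flats (c₁ ∷ c₂ ∷ c₃ ∷ cs)) (suc k)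
  LB²-triple {c₁ = c₁} {c₂} {c₃} {cs} {k} v@(valid _ ((p ∷ q ∷ _) ∷ (r ∷ _) ∷ _) _) conv h₁ h₂ h₃ =
    LB²-branch (triple c₁ c₂ c₃) v conv
      (triple-all {P = _∈ c₁ ∷ c₂ ∷ c₃ ∷ cs} (here refl) (there (here refl)) (there (there (here refl))))
      (triple-pairs {R = Apart E} (λ {c} {d} → Apart-sym {c} {d}) p q r _ _)
      (triple-all {P = λ c → LB (E² E) (flat c) (flats (children c)) k} h₁ h₂ h₃)

  LB-triple : ∀ {x c₁ c₂ c₃ cs k} → Valid E (node x (c₁ ∷ c₂ ∷ c₃ ∷ cs)) → LB E (flat c₁) (flats (children c₁)) k →
              LB E (flat c₂) (flats (children c₂)) k → LB E (flat c₃) (flats (children c₃)) k →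
              LB E (flat (node x (c₁ ∷ c₂ ∷ c₃ ∷ cs))) (flat (node x (c₁ ∷ c₂ ∷ c₃ ∷ cs))) (suc k)
  LB-triple {c₁ = c₁} {c₂} {c₃} {cs} {k} v@(valid _ ((p ∷ q ∷ _) ∷ (r ∷ _) ∷ _) _) h₁ h₂ h₃ =
    LB-branch (triple c₁ c₂ c₃) v
      (triple-all {P = _∈ c₁ ∷ c₂ ∷ c₃ ∷ cs} (here refl) (there (here refl)) (there (there (here refl))))
      (triple-pairs {R = Apart E} (λ {c} {d} → Apart-sym {c} {d}) p q r _ _)
      (triple-all {P = λ c → LB E (flat c) (flats (children c)) k} h₁ h₂ h₃)

  LB²-resp-↭ : ∀ {S S′ k} → S ↭ S′ → LB (E² E) S S k → LB (E² E) S′ S′ k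
  LB²-resp-↭ p = LB-mono (∈-resp-↭ p) (∈-resp-↭ p)

  partition : ∀ {m} cs → All (λ c → Light m c ⊎ Heavy m c) cs →
              ∃₂ λ hs ls → cs ↭ hs ++ ls × All (Heavy m) hs × All (Light m) ls
  partition [] [] = [] , [] , ↭-refl , [] , []
  partition (c ∷ cs) (lh ∷ lhs) with hs , ls , p , h , l ← partition cs lhs with lh
  ... | inj₁ lc = hs , c ∷ ls , ↭-trans (prep c p) (↭-sym (shift c hs ls)) , h , lc ∷ l
  ... | inj₂ hc = c ∷ hs , ls , prep c p , hc ∷ h , l

  module Step {m} (dichotomy : Dichotomy m) where

    classify : ∀ {x cs} → Valid E (node x cs) → Convex E (flat (node x cs)) →
               ∀ ds → (∀ {d} → d ∈ ds → d ∈ cs) →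
               ∃₂ λ hs ls → ds ↭ hs ++ ls × All (Heavy m) hs × All (Light m) ls
    classify {x} {cs} v conv ds ds⊆cs = partition ds (All.tabulate λ {d} d∈ →
      type d (Valid-child v (ds⊆cs d∈)) (Convex-child v conv (ds⊆cs d∈)))
      where
      type : ∀ c → Valid E c → Convex E (flat c) → Light m c ⊎ Heavy m c
      type (node y ds) vc convc = go ds id
        where
        go : ∀ es → (∀ {d} → d ∈ es → d ∈ ds) → Light m (node y es) ⊎ Heavy m (node y ds)
        go [] _ = inj₁ []
        go (d ∷ es) sub with dichotomy d (Valid-child vc (sub (here refl))) (Convex-child vc convc (sub (here refl)))
        ... | inj₂ lb = inj₂ (LB-mono (there ∘ ∈-flats⁺ (sub (here refl))) (∈-flats⁺ (sub (here refl))) lb)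
        ... | inj₁ ub with go es (sub ∘ there)
        ...   | inj₁ l = inj₁ (ub ∷ l)
        ...   | inj₂ h = inj₂ h

    Large : Rose V → Set
    Large t = LB (E² E) (flat t) (flat t) (suc (suc m))

    Large-resp-↭ : ∀ {x cs ds} → cs ↭ ds → Large (node x cs) → Large (node x ds)
    Large-resp-↭ p = LB²-resp-↭ (prep _ (flats-↭ p))

    Convex-children : ∀ {x cs ds} → cs ↭ ds → Convex E (flat (node x cs)) → Convex E (flat (node x ds))
    Convex-children p = Convex-resp-↭ (prep _ (flats-↭ p))

    -- `up` is the rest of the tree as seen from the root of `t`. Since it is heavy, either `t` has
    -- at most one heavy child and the path continues there, or three heavy neighbours meet.
    Descent : Rose V → Set
    Descent t = ∀ up → Valid E (node (root t) (up ∷ children t)) →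
                Convex E (flat (node (root t) (up ∷ children t))) → Heavy m up →
                Large (node (root t) (up ∷ children t)) ⊎ RootedUB t (suc m)

    -- Both the cut and the matching of `c` lie strictly below `e`.
    heavy-parent : ∀ {e c cs} → c ∈ cs → Heavy m c → Heavy m (node e cs)
    heavy-parent {c = c} c∈ = LB-mono (there ∘ ∈-flats⁺ c∈) (∈-flats⁺ c∈ ∘ flats⊆flat c)

    Convex-reroot : ∀ e v ds cs → Convex E (flat (node e (node v ds ∷ cs))) →
                    Convex E (flat (node v (node e cs ∷ ds)))
    Convex-reroot e v ds cs = Convex-resp-↭ (flat-reroot e v ds cs)

    Large-unroot : ∀ e v ds cs → Large (node v (node e cs ∷ ds)) → Large (node e (node v ds ∷ cs))
    Large-unroot e v ds cs = LB²-resp-↭ (↭-sym (flat-reroot e v ds cs))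

    descent : ∀ t → Descent t
    descent = Rose-ind step
      where
      step : ∀ e cs → All Descent cs → Descent (node e cs)
      step e cs ih up v conv hup with classify v conv cs there
      ... | [] , ls , p , [] , l =
        inj₂ (RootedUB-resp-↭ (↭-sym p) (RootedUB-star (Valid-resp-↭ p (Valid-tail v)) l))
      ... | h@(node w ds) ∷ [] , ls , p , hh ∷ [] , l =
        Sum.map (Large-resp-↭ (↭-sym q) ∘ Large-unroot e w ds (up ∷ ls))
          (RootedUB-resp-↭ (↭-sym p) ∘ RootedUB-path (Valid-resp-↭ p (Valid-tail v)) l)
          -- Seen from the heavy child, the rest of the tree is rooted at `e`; it is heavy because
          -- it contains `up`.
          (All.head (All-resp-↭ p ih) (node e (up ∷ ls))
            (Valid-reroot (Valid-resp-↭ q v)) (Convex-reroot e w ds (up ∷ ls) (Convex-children q conv))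
            (heavy-parent {cs = up ∷ ls} (here refl) hup))
        where
        q : up ∷ cs ↭ h ∷ up ∷ ls
        q = ↭-trans (prep up p) (swap up h ↭-refl)
      -- `up` is the third heavy neighbour.
      ... | h₁ ∷ h₂ ∷ hs , ls , p , hh₁ ∷ hh₂ ∷ _ , l =
        inj₁ (Large-resp-↭ (prep up (↭-sym p))
          (LB-mono there there
            (LB²-triple (Valid-resp-↭ (prep up p) v) (Convex-children (prep up p) conv) hup hh₁ hh₂)))

    -- `ups` is the part above `t`, whose weight is left open. As long as there is at most one heavy
    -- child it can stay open: the last alternative lays out `t` alone, and the ancestors on the
    -- path add their own light subtrees afterwards.
    Search : Rose V → Set
    Search t = ∀ ups → Valid E (node (root t) (ups ++ children t)) →
               Convex E (flat (node (root t) (ups ++ children t))) →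
               (Large (node (root t) (ups ++ children t)) ⊎ UB E (flat (node (root t) (ups ++ children t))) (suc m))
               ⊎ RootedUB t (suc m)

    two-heavy : ∀ {e h₁ h₂ ls} → Valid E (node e (h₁ ∷ h₂ ∷ ls)) → Convex E (flat (node e (h₁ ∷ h₂ ∷ ls))) →
                Heavy m h₁ → Heavy m h₂ → All (Light m) ls →
                Large (node e (h₁ ∷ h₂ ∷ ls)) ⊎ UB E (flat (node e (h₁ ∷ h₂ ∷ ls))) (suc m)
    two-heavy {e} {h₁@(node w₁ ds₁)} {h₂@(node w₂ ds₂)} {ls} v conv hh₁ hh₂ l
      with descent h₁ (node e (h₂ ∷ ls)) (Valid-reroot v)
             (Convex-reroot e w₁ ds₁ (h₂ ∷ ls) conv)
             (heavy-parent {cs = h₂ ∷ ls} (here refl) hh₂)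
         | descent h₂ (node e (h₁ ∷ ls)) (Valid-reroot (Valid-resp-↭ (swap h₁ h₂ ↭-refl) v))
             (Convex-reroot e w₂ ds₂ (h₁ ∷ ls) (Convex-children (swap h₁ h₂ (↭-refl {x = ls})) conv))
             (heavy-parent {cs = h₁ ∷ ls} (here refl) hh₁)
    ... | inj₁ large | _          = inj₁ (Large-unroot e w₁ ds₁ (h₂ ∷ ls) large)
    ... | inj₂ _     | inj₁ large =
      inj₁ (Large-resp-↭ (swap h₂ h₁ (↭-refl {x = ls})) (Large-unroot e w₂ ds₂ (h₁ ∷ ls) large))
    -- The path runs through both heavy neighbours: up from `h₁` in reverse, through `e` with its
    -- light subtrees, then down into `h₂`.
    ... | inj₂ r₁    | inj₂ r₂    = inj₂ (UB-join v r₁ (RootedUB-path (Valid-tail v) l r₂))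

    search : ∀ t → Search t
    search = Rose-ind step
      where
      step : ∀ e cs → All Search cs → Search (node e cs)
      step e cs ih ups v conv with classify v conv cs (∈-++⁺ʳ ups)
      ... | [] , ls , p , [] , l =
        inj₂ (RootedUB-resp-↭ (↭-sym p) (RootedUB-star (Valid-suffix ups (Valid-resp-↭ (++⁺ˡ ups p) v)) l))
      ... | h@(node w ds) ∷ [] , ls , p , hh ∷ [] , l =
        Sum.map (Sum.map (Large-resp-↭ (↭-sym q) ∘ Large-unroot e w ds (ups ++ ls))
                         (UB-resp-↭ (↭-trans (↭-sym (flat-reroot e w ds (ups ++ ls))) (prep e (flats-↭ (↭-sym q))))))
          (RootedUB-resp-↭ (↭-sym p) ∘ RootedUB-path (Valid-suffix ups (Valid-resp-↭ (++⁺ˡ ups p) v)) l)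
          (All.head (All-resp-↭ p ih) [ node e (ups ++ ls) ]
            (Valid-reroot (Valid-resp-↭ q v)) (Convex-reroot e w ds (ups ++ ls) (Convex-children q conv)))
        where
        q : ups ++ cs ↭ h ∷ ups ++ ls
        q = ↭-trans (++⁺ˡ ups p) (shift h ups ls)
      ... | h₁ ∷ h₂ ∷ hs , ls , p , hh₁ ∷ hh₂ ∷ _ , _ =
        -- With two heavy children found, the weight of `ups` matters, so it is classified together
        -- with the remaining children: a third heavy neighbour yields the wide cut, none yields a
        -- path through `e`.
        inj₁ (rest (classify v conv others (∈-resp-↭ (↭-sym q) ∘ there ∘ there)))
        where
        others : List (Rose V)
        others = ups ++ hs ++ ls
        q : ups ++ cs ↭ h₁ ∷ h₂ ∷ others
        q = ↭-trans (++⁺ˡ ups p)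
          (↭-trans (shift h₁ ups (h₂ ∷ hs ++ ls)) (prep h₁ (shift h₂ ups (hs ++ ls))))
        rest : (∃₂ λ hs ls → others ↭ hs ++ ls × All (Heavy m) hs × All (Light m) ls) →
               Large (node e (ups ++ cs)) ⊎ UB E (flat (node e (ups ++ cs))) (suc m)
        rest ([] , ls , p , [] , l) =
          Sum.map (Large-resp-↭ (↭-sym r)) (UB-resp-↭ (prep e (flats-↭ (↭-sym r))))
            (two-heavy (Valid-resp-↭ r v) (Convex-children r conv) hh₁ hh₂ l)
          where
          r : ups ++ cs ↭ h₁ ∷ h₂ ∷ ls
          r = ↭-trans q (prep h₁ (prep h₂ p))
        rest (h₃ ∷ hs , ls , p , hh₃ ∷ _ , _) =
          inj₁ (Large-resp-↭ (↭-sym r)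
            (LB-mono there there (LB²-triple (Valid-resp-↭ r v) (Convex-children r conv) hh₁ hh₂ hh₃)))
          where
          r : ups ++ cs ↭ h₁ ∷ h₂ ∷ h₃ ∷ hs ++ ls
          r = ↭-trans q (prep h₁ (prep h₂ p))

  dichotomy : ∀ m → Dichotomy m
  dichotomy zero (node x []) v conv = inj₁ ([ x ] , ↭-refl , Width-[x])
  dichotomy zero (node x (c ∷ cs)) (valid ((xc , _) ∷ _) _ _) conv = inj₂ edge
    where
    r∈ : root c ∈ flats (c ∷ cs)
    r∈ = ∈-flats⁺ {cs = c ∷ cs} (here refl) (root∈flat c)
    edge : LB (E² E) (flat (node x (c ∷ cs))) (flat (node x (c ∷ cs))) 1
    edge pos inj with ℕ.<-cmp (pos x) (pos (root c))
    ... | tri< x<c _ _ = x , here refl , [ x , root c ] , refl ,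
      ((here refl , ℕ.≤-refl) , (there r∈ , x<c) , E⊆E² xc) ∷ [] , [] ∷ []
    ... | tri≈ _ eq _  = contradiction (subst (E x) (≡.sym (inj eq)) xc) E-irrefl
    ... | tri> _ _ c<x = root c , there r∈ , [ root c , x ] , refl ,
      ((there r∈ , ℕ.≤-refl) , (here refl , c<x) , E⊆E² (E-sym xc)) ∷ [] , [] ∷ []
  dichotomy (suc m) t@(node x cs) v conv with Step.search (dichotomy m) t [] v conv
  ... | inj₁ (inj₁ large) = inj₂ large
  ... | inj₁ (inj₂ ub)    = inj₁ ub
  -- Nothing lies above the root here, so this layout covers the whole tree.
  ... | inj₂ r            = inj₁ (RootedUB⇒UB t r)

-- Widths of graphs on Fin n

AllPairs-lookup-≢ : ∀ {A : Set} {R : Rel A 0ℓ} → Symmetric R → ∀ {xs} → AllPairs R xs →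
                    ∀ {i j} → i ≢ j → R (lookup xs i) (lookup xs j)
AllPairs-lookup-≢ R-sym (r ∷ rs) {zero}  {zero}  ne = contradiction refl ne
AllPairs-lookup-≢ R-sym (r ∷ rs) {zero}  {suc j} ne = All.lookup r (∈-lookup j)
AllPairs-lookup-≢ R-sym (r ∷ rs) {suc i} {zero}  ne = R-sym (All.lookup r (∈-lookup i))
AllPairs-lookup-≢ R-sym (r ∷ rs) {suc i} {suc j} ne = AllPairs-lookup-≢ R-sym rs (ne ∘ cong suc)

lookup-injective : ∀ {A : Set} {xs : List A} → Unique xs → ∀ {i j} → lookup xs i ≡ lookup xs j → i ≡ j
lookup-injective u {i} {j} eq with i Fin.≟ j
... | yes i≡j = i≡j
... | no  i≢j = contradiction eq (AllPairs-lookup-≢ (λ ne → ne ∘ ≡.sym) u i≢j)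

module _ {G : Graph n} {S : Subset n} where

  induced⇒matching : ∀ {k} → HasInducedMatching (bipartite G S (∁ S)) k →
                     ∃[ M ] length M ≡ k × Matching (Adj G) (_∈ˢ S) (_∉ˢ S) M
  induced⇒matching {k} (e , im) =
    tabulate (λ i → proj₁ (orient i)) , length-tabulate _ ,
    Allₚ.tabulate⁺ (λ i → proj₁ (proj₂ (orient i))) ,
    AllPairsₚ.tabulate⁺ (λ {i} {j} i≢j → avoid i j i≢j , λ q → avoid j i (i≢j ∘ ≡.sym) q)
    where
    open IsInducedMatching im
    orient : ∀ i → ∃[ f ] Crossing (Adj G) (_∈ˢ S) (_∉ˢ S) f × proj₁ f ∈ₑ e i × proj₂ f ∈ₑ e i
    orient i with e i | edge i
    ... | u , v | uv , inj₁ (u∈ , v∈) = (u , v) , (u∈ , x∈∁p⇒x∉p v∈ , uv) , inj₁ refl , inj₂ refl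
    ... | u , v | uv , inj₂ (u∈ , v∈) = (v , u) , (v∈ , x∈∁p⇒x∉p u∈ , adj-sym G uv) , inj₂ refl , inj₁ refl
    avoid : ∀ i j → i ≢ j → ¬ Adj G (proj₁ (proj₁ (orient i))) (proj₂ (proj₁ (orient j)))
    avoid i j i≢j q with orient i | orient j
    ... | _ , (a∈ , _) , a∈ₑ , _ | _ , (_ , b∉ , _) , _ , b∈ₑ =
      induced i j i≢j _ _ a∈ₑ b∈ₑ (q , inj₁ (a∈ , x∉p⇒x∈∁p b∉))

  matching⇒induced : ∀ {M} → Matching (Adj G) (_∈ˢ S) (_∉ˢ S) M →
                     HasInducedMatching (bipartite G S (∁ S)) (length M)
  matching⇒induced {M} (cs , ps) = lookup M , record
    { edge     = λ i → let (a∈ , b∉ , q) = cr i in q , inj₁ (a∈ , x∉p⇒x∈∁p b∉)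
    ; disjoint = disj
    ; induced  = ind
    }
    where
    cr : ∀ i → Crossing (Adj G) (_∈ˢ S) (_∉ˢ S) (lookup M i)
    cr i = All.lookup cs (∈-lookup i)
    compat : ∀ {i j} → i ≢ j → Compatible (Adj G) (lookup M i) (lookup M j)
    compat = AllPairs-lookup-≢ (Compatible-sym (Adj G)) ps
    disj : ∀ i j → i ≢ j → ∀ x y → x ∈ₑ lookup M i → y ∈ₑ lookup M j → x ≢ y
    disj i j i≢j x y (inj₁ refl) (inj₁ refl) eq = proj₂ (compat i≢j) (subst (λ z → Adj G z _) eq (proj₂ (proj₂ (cr i))))
    disj i j i≢j x y (inj₁ refl) (inj₂ refl) eq = proj₁ (proj₂ (cr j)) (subst (_∈ˢ S) eq (proj₁ (cr i)))
    disj i j i≢j x y (inj₂ refl) (inj₁ refl) eq = proj₁ (proj₂ (cr i)) (subst (_∈ˢ S) (≡.sym eq) (proj₁ (cr j)))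
    disj i j i≢j x y (inj₂ refl) (inj₂ refl) eq = proj₁ (compat i≢j) (subst (Adj G _) eq (proj₂ (proj₂ (cr i))))
    ind : ∀ i j → i ≢ j → ∀ x y → x ∈ₑ lookup M i → y ∈ₑ lookup M j → ¬ Adj (bipartite G S (∁ S)) x y
    ind i j i≢j x y (inj₁ refl) (inj₁ refl) (q , inj₁ (_ , y∈)) = x∈∁p⇒x∉p y∈ (proj₁ (cr j))
    ind i j i≢j x y (inj₁ refl) (inj₁ refl) (q , inj₂ (x∈ , _)) = x∈∁p⇒x∉p x∈ (proj₁ (cr i))
    ind i j i≢j x y (inj₁ refl) (inj₂ refl) (q , _)             = proj₁ (compat i≢j) q
    ind i j i≢j x y (inj₂ refl) (inj₁ refl) (q , _)             = proj₂ (compat i≢j) (adj-sym G q)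
    ind i j i≢j x y (inj₂ refl) (inj₂ refl) (q , inj₁ (x∈ , _)) = proj₁ (proj₂ (cr i)) x∈
    ind i j i≢j x y (inj₂ refl) (inj₂ refl) (q , inj₂ (_ , y∈)) = proj₁ (proj₂ (cr j)) y∈

∈-prefix⁺ : ∀ (σ : Layout n) i {v} → toℕ (σ ⟨$⟩ʳ v) < i → v ∈ˢ prefix σ i
∈-prefix⁺ σ i {v} lt = lookup⇒[]= v _ (≡.trans (lookup∘tabulate _ v) (dec-true (toℕ (σ ⟨$⟩ʳ v) ℕ.<? i) lt))

∈-prefix⁻ : ∀ (σ : Layout n) i {v} → v ∈ˢ prefix σ i → toℕ (σ ⟨$⟩ʳ v) < i
∈-prefix⁻ σ i {v} v∈ = true⇒ (toℕ (σ ⟨$⟩ʳ v) ℕ.<? i)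
  (≡.trans (≡.sym (lookup∘tabulate (λ v → does (toℕ (σ ⟨$⟩ʳ v) ℕ.<? i)) v)) ([]=⇒lookup v∈))
  where
  true⇒ : ∀ {A : Set} (a? : Dec A) → does a? ≡ true → A
  true⇒ (yes a) _ = a

CutMatching : Layout n → Graph n → ℕ → List (Fin n × Fin n) → Set
CutMatching σ G i = Matching (Adj G) (λ v → toℕ (σ ⟨$⟩ʳ v) < i) (λ v → ¬ toℕ (σ ⟨$⟩ʳ v) < i)

mw≤⁺ : ∀ (σ : Layout n) G {k} → (∀ i {M} → CutMatching σ G i M → length M ≤ k) → mw σ G ≤ k
mw≤⁺ {n} σ G {k} bound = Extrema.max≤v⁺ z≤n (Allₚ.applyUpTo⁺₂ _ (n ∸ 1) λ j → mim≤ (suc j))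
  where
  mim≤ : ∀ i → mim (cut σ G i) ≤ k
  mim≤ i with M , eq , m ← induced⇒matching {G = G} {prefix σ i} (proj₁ (proj₂ (mim-exists (cut σ G i)))) =
    ℕ.≤-trans (ℕ.≤-reflexive (≡.sym eq)) (bound i
      (Matching-mapAll (λ (a∈ , b∉ , q) → ∈-prefix⁻ σ i a∈ , b∉ ∘ ∈-prefix⁺ σ i , q) m))

-- Cuts outside the range of the maximum have an empty side, so an edge of the matching certifies
-- that `i` lies in the range.
≤mw : ∀ (σ : Layout n) G i {M} → CutMatching σ G i M → length M ≤ mw σ G
≤mw σ G i {[]} _ = z≤n
≤mw σ G zero {_ ∷ _} ((() , _) ∷ _ , _)
≤mw {suc n} σ G (suc j) {M@((a , b) ∷ _)} m@((_ , b≮ , _) ∷ _ , _) =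
  Extrema.v≤max⁺ 0 (applyUpTo (λ j → mim (cut σ G (suc j))) n) (inj₂ (Anyₚ.applyUpTo⁺ _ ≤mim j<n))
  where
  ≤mim : length M ≤ mim (cut σ G (suc j))
  ≤mim = proj₂ (proj₂ (mim-exists (cut σ G (suc j)))) (length M) (matching⇒induced {G = G} {prefix σ (suc j)}
    (Matching-mapAll (λ (a< , b≮ , q) → ∈-prefix⁺ σ (suc j) a< , b≮ ∘ ∈-prefix⁻ σ (suc j) , q) m))
  j<n : j < n
  j<n = ℕ.≤-pred (ℕ.≤-<-trans (ℕ.≮⇒≥ b≮) (Fin.toℕ<n (σ ⟨$⟩ʳ b)))

lmw≤mw : ∀ (G : Graph n) σ → lmw G ≤ mw σ G
lmw≤mw G σ = proj₂ (proj₂ (lmw-exists G)) _ (σ , refl)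

optimal : ∀ (G : Graph n) → ∃[ σ ] mw σ G ≡ lmw G
optimal G = proj₁ (proj₂ (lmw-exists G))

position-injective : ∀ (σ : Layout n) {a b} → toℕ (σ ⟨$⟩ʳ a) ≡ toℕ (σ ⟨$⟩ʳ b) → a ≡ b
position-injective σ e =
  ≡.trans (≡.sym (inverseˡ σ)) (≡.trans (cong (σ ⟨$⟩ˡ_) (Fin.toℕ-injective e)) (inverseˡ σ))

LB⇒≤lmw : ∀ {G : Graph n} {W S k} → LB (Adj G) W S k → k ≤ lmw G
LB⇒≤lmw {n} {G} {k = k} lb with σ , eq ← optimal G
  with w , _ , M , refl , m ← lb (λ v → toℕ (σ ⟨$⟩ʳ v)) (position-injective σ) =
  -- Positions count from zero, so the prefix ending in `w` has one more element than the position
  -- of `w`.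
  ℕ.≤-trans (≤mw σ G (suc (toℕ (σ ⟨$⟩ʳ w)))
    (Matching-mapAll (λ ((_ , a≤) , (_ , <b) , q) → s≤s a≤ , ℕ.<⇒≱ <b ∘ ℕ.≤-pred , q) m)) (ℕ.≤-reflexive eq)

take-index : ∀ {A : Set} {xs : List A} {x} (p : x ∈ xs) i → toℕ (index p) < i → x ∈ take i xs
take-index (here eq) (suc i) _  = here eq
take-index (there p) (suc i) lt = there (take-index p i (ℕ.≤-pred lt))

drop-index : ∀ {A : Set} {xs : List A} {x} (p : x ∈ xs) i → ¬ toℕ (index p) < i → x ∈ drop i xs
drop-index p         zero    _  = p
drop-index (here eq) (suc i) ≮ = contradiction (s≤s z≤n) ≮
drop-index (there p) (suc i) ≮ = drop-index p i (≮ ∘ s≤s)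

listLayout : ∀ {L : List (Fin n)} → Unique L → (∀ v → v ∈ L) →
             Σ (Layout n) λ σ → Σ (∀ v → v ∈ L) λ v∈ → ∀ v → toℕ (σ ⟨$⟩ʳ v) ≡ toℕ (index (v∈ v))
listLayout {n} {L} u v∈ = permutation to from to∘from from∘to , v∈ , λ v → Fin.toℕ-cast len (index (v∈ v))
  where
  index-injective : ∀ {v w} → index (v∈ v) ≡ index (v∈ w) → v ≡ w
  index-injective {v} {w} eq = ≡.trans (Anyₚ.lookup-index (v∈ v))
    (≡.trans (cong (lookup L) eq) (≡.sym (Anyₚ.lookup-index (v∈ w))))
  len : length L ≡ n
  len = ℕ.≤-antisym (Fin.injective⇒≤ (lookup-injective u)) (Fin.injective⇒≤ index-injective)
  to : Fin n → Fin n
  to v = Fin.cast len (index (v∈ v))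
  from : Fin n → Fin n
  from i = lookup L (Fin.cast (≡.sym len) i)
  from∘to : ∀ v → from (to v) ≡ v
  from∘to v = ≡.trans (cong (lookup L) (Fin.cast-involutive (≡.sym len) len _)) (≡.sym (Anyₚ.lookup-index (v∈ v)))
  to∘from : ∀ i → to (from i) ≡ i
  to∘from i = ≡.trans (cong (Fin.cast len) (lookup-injective u (≡.sym (Anyₚ.lookup-index (v∈ (from i))))))
    (Fin.cast-involutive len (≡.sym len) i)

UB⇒lmw≤ : ∀ {G : Graph n} {S k} → Unique S → (∀ v → v ∈ S) → UB (Adj G) S k → lmw G ≤ k
UB⇒lmw≤ {G = G} u v∈S (L , L↭ , w)
  with σ , v∈ , σ≡ ← listLayout (AllPairs-resp-↭ (λ ne → ne ∘ ≡.sym) (↭-sym L↭) u) (λ v → ∈-resp-↭ (↭-sym L↭) (v∈S v)) =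
  ℕ.≤-trans (lmw≤mw G σ) (mw≤⁺ σ G λ i m → w (take i L) (drop i L) (take++drop≡id i L)
    (Matching-mapAll (λ {e} (a< , b≮ , q) →
      take-index (v∈ _) i (subst (_< i) (σ≡ _) a<) ,
      drop-index (v∈ _) i (b≮ ∘ subst (_< i) (≡.sym (σ≡ _))) , q) m))

E²⇒Adj² : ∀ {G : Graph n} {u v} → E² (Adj G) u v → Adj (G ²) u v
E²⇒Adj² (u≢v , inj₁ e)           = u≢v , 1 , s≤s z≤n , e ∷ []
E²⇒Adj² (u≢v , inj₂ (c , e , f)) = u≢v , 2 , s≤s (s≤s z≤n) , e ∷ f ∷ []

Adj²⇒E² : ∀ {G : Graph n} {u v} → Adj (G ²) u v → E² (Adj G) u v
Adj²⇒E² (u≢v , 0 , _ , [])         = contradiction refl u≢v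
Adj²⇒E² (u≢v , 1 , _ , e ∷ [])     = u≢v , inj₁ e
Adj²⇒E² (u≢v , 2 , _ , e ∷ f ∷ []) = u≢v , inj₂ (_ , e , f)
Adj²⇒E² (u≢v , suc (suc (suc _)) , s≤s (s≤s ()) , _)

Matching-⇔ : ∀ {V : Set} {Q R : Rel V 0ℓ} → (∀ {a b} → Q a b → R a b) → (∀ {a b} → R a b → Q a b) →
             ∀ {A B M} → Matching Q A B M → Matching R A B M
Matching-⇔ to from (cs , ps) =
  All.map (λ (a , b , q) → a , b , to q) cs , AllPairs.map (λ (p , q) → p ∘ from , q ∘ from) ps

LB²⇒≤lmw² : ∀ {G : Graph n} {W S k} → LB (E² (Adj G)) W S k → k ≤ lmw (G ²)
LB²⇒≤lmw² {G = G} lb = LB⇒≤lmw {G = G ²} λ pos inj →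
  let w , w∈ , M , eq , m = lb pos inj in w , w∈ , M , eq , Matching-⇔ (E²⇒Adj² {G = G}) (Adj²⇒E² {G = G}) m

UB²⇒lmw²≤ : ∀ {G : Graph n} {S k} → Unique S → (∀ v → v ∈ S) → UB (E² (Adj G)) S k → lmw (G ²) ≤ k
UB²⇒lmw²≤ {G = G} u v∈ (L , L↭ , w) = UB⇒lmw≤ {G = G ²} u v∈
  (L , L↭ , λ A B eq m → w A B eq (Matching-⇔ (Adj²⇒E² {G = G}) (E²⇒Adj² {G = G}) m))

-- The square under a fixed layout, and rooting a graph that is a tree

Split : ∀ {A : Set} → Rel A 0ℓ → (P P′ : A → Set) → List A → Set
Split R P P′ M = ∃₂ λ M₁ M₂ → length M ≡ length M₁ + length M₂ ×
  (All P M₁ × AllPairs R M₁) × (All P′ M₂ × AllPairs R M₂) × (∀ {e} → e ∈ M₁ ⊎ e ∈ M₂ → e ∈ M)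

All-split : ∀ {A : Set} {R : Rel A 0ℓ} {P P′ : A → Set} {M} →
            All (λ e → P e ⊎ P′ e) M → AllPairs R M → Split R P P′ M
All-split [] [] = [] , [] , refl , ([] , []) , ([] , []) , λ { (inj₁ ()) ; (inj₂ ()) }
All-split {M = e ∷ _} (s ∷ ss) (r ∷ rs)
  with M₁ , M₂ , eq , (p , a) , (q , b) , sub ← All-split ss rs with s
... | inj₁ pe = e ∷ M₁ , M₂ , cong suc eq ,
  (pe ∷ p , All.tabulate (λ x∈ → All.lookup r (sub (inj₁ x∈))) ∷ a) , (q , b) ,
  λ { (inj₁ (here x≡e)) → here x≡e ; (inj₁ (there x∈)) → there (sub (inj₁ x∈)) ; (inj₂ x∈) → there (sub (inj₂ x∈)) }
... | inj₂ qe = M₁ , e ∷ M₂ , ≡.trans (cong suc eq) (≡.sym (ℕ.+-suc _ _)) ,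
  (p , a) , (qe ∷ q , All.tabulate (λ x∈ → All.lookup r (sub (inj₂ x∈))) ∷ b) ,
  λ { (inj₁ x∈) → there (sub (inj₁ x∈)) ; (inj₂ (here x≡e)) → here x≡e ; (inj₂ (there x∈)) → there (sub (inj₂ x∈)) }

module _ {A B : Set} {P : A → Set} (f : ∀ {x} → P x → B) where

  length-reduce : ∀ {xs} (ps : All P xs) → length (All.reduce f ps) ≡ length xs
  length-reduce []       = refl
  length-reduce (_ ∷ ps) = cong suc (length-reduce ps)

  All-reduce⁺ : ∀ {R : A → Set} {S : B → Set} → (∀ {x} (p : P x) → R x → S (f p)) →
                ∀ {xs} (ps : All P xs) → All R xs → All S (All.reduce f ps)
  All-reduce⁺ h []       []       = []
  All-reduce⁺ h (p ∷ ps) (r ∷ rs) = h p r ∷ All-reduce⁺ h ps rs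

  AllPairs-reduce⁺ : ∀ {R : Rel A 0ℓ} {S : Rel B 0ℓ} →
                     (∀ {x y} (p : P x) (q : P y) → R x y → S (f p) (f q)) →
                     ∀ {xs} (ps : All P xs) → AllPairs R xs → AllPairs S (All.reduce f ps)
  AllPairs-reduce⁺ h []       []       = []
  AllPairs-reduce⁺ h (p ∷ ps) (r ∷ rs) = All-reduce⁺ (h p) ps r ∷ AllPairs-reduce⁺ h ps rs

-- A crossing edge ab of the square contains a crossing edge of E at a or at b, and the edges
-- found at the A-side (or at the B-side) endpoints again form an induced matching.
square-cut : ∀ {V : Set} {E : Rel V 0ℓ} {A : V → Set} → Symmetric E → Decidable A → ∀ {k} →
             (∀ {M} → Matching E A (¬_ ∘ A) M → length M ≤ k) →
             ∀ {M} → Matching (E² E) A (¬_ ∘ A) M → length M ≤ 2 * k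
square-cut {V} {E} {A} E-sym A? {k} bound {M} (cs , ps) = count {M} (All-split (All.map classify cs) ps)
  where
  AtLeft AtRight : V × V → Set
  AtLeft  (a , b) = A a × ¬ A b × ∃[ c ] E a c × ¬ A c × (c ≡ b ⊎ E c b)
  AtRight (a , b) = A a × ¬ A b × ∃[ c ] E c b × A c × E a c

  classify : ∀ {e} → Crossing (E² E) A (¬_ ∘ A) e → AtLeft e ⊎ AtRight e
  -- A direct edge is counted at `a`, with `b` itself in the role of the midpoint.
  classify (a∈ , b∉ , _ , inj₁ e) = inj₁ (a∈ , b∉ , _ , e , b∉ , inj₁ refl)
  classify (a∈ , b∉ , _ , inj₂ (c , e , f)) with A? c
  ... | yes c∈ = inj₂ (a∈ , b∉ , c , f , c∈ , e)
  ... | no  c∉ = inj₁ (a∈ , b∉ , c , e , c∉ , inj₂ f)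

  left : ∀ {e} → AtLeft e → V × V
  left {a , _} (_ , _ , c , _) = a , c
  right : ∀ {e} → AtRight e → V × V
  right {_ , b} (_ , _ , c , _) = c , b

  -- An edge from `a` to the midpoint of another pair would continue to the end `b` of that pair
  -- within two steps, contradicting inducedness in the square.
  left-apart : ∀ {e f} (p : AtLeft e) (q : AtLeft f) → ¬ E² E (proj₁ e) (proj₂ f) →
               ¬ E (proj₁ (left p)) (proj₂ (left q))
  left-apart (a∈ , _) (_ , b∉ , _ , _ , _ , inj₁ refl) ¬q e = ¬q ((λ { refl → b∉ a∈ }) , inj₁ e)
  left-apart (a∈ , _) (_ , b∉ , c , _ , _ , inj₂ f)    ¬q e = ¬q ((λ { refl → b∉ a∈ }) , inj₂ (c , e , f))

  right-apart : ∀ {e f} (p : AtRight e) (q : AtRight f) → ¬ E² E (proj₁ e) (proj₂ f) →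
                ¬ E (proj₁ (right p)) (proj₂ (right q))
  right-apart (a∈ , _ , c , _ , _ , f) (_ , b∉ , _) ¬q e = ¬q ((λ { refl → b∉ a∈ }) , inj₂ (c , f , e))

  count : ∀ {M} → Split (Compatible (E² E)) AtLeft AtRight M → length M ≤ 2 * k
  count {M} (M₁ , M₂ , eq , (l , ls) , (r , rs) , _) = begin
    length M                                              ≡⟨ eq ⟩
    length M₁ + length M₂                                 ≡⟨ ≡.cong₂ _+_
      (length-reduce left l) (length-reduce right r) ⟨
    length (All.reduce left l) + length (All.reduce right r) ≤⟨ ℕ.+-mono-≤
      (bound ( All-reduce⁺ left {R = λ _ → ⊤} (λ (a∈ , _ , _ , e , c∉ , _) _ → a∈ , c∉ , e) l (All.universal _ M₁)
             , AllPairs-reduce⁺ left (λ p q (c , d) → left-apart p q c , left-apart q p d) l ls))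
      (bound ( All-reduce⁺ right {R = λ _ → ⊤} (λ (_ , b∉ , _ , e , c∈ , _) _ → c∈ , b∉ , e) r (All.universal _ M₂)
             , AllPairs-reduce⁺ right (λ p q (c , d) → right-apart p q c , right-apart q p d) r rs)) ⟩
    k + k                                                 ≡⟨ cong (k +_) (ℕ.+-identityʳ k) ⟨
    2 * k                                                 ∎
    where open ℕ.≤-Reasoning

lmw²≤2*lmw : ∀ (G : Graph n) → lmw (G ²) ≤ 2 * lmw G
lmw²≤2*lmw G with σ , eq ← optimal G =
  ℕ.≤-trans (lmw≤mw (G ²) σ) (mw≤⁺ σ (G ²) λ i m →
    square-cut (adj-sym G) (λ v → toℕ (σ ⟨$⟩ʳ v) ℕ.<? i)
      (λ m′ → ℕ.≤-trans (≤mw σ G i m′) (ℕ.≤-reflexive eq))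
      (Matching-⇔ (Adj²⇒E² {G = G}) (E²⇒Adj² {G = G}) m))

-- Rooting an acyclic connected graph

module _ {G : Graph n} where

  vertex : ∀ {l u w} → Walk G l u w → Fin (suc l) → Fin n
  vertex {u = u} _       zero    = u
  vertex         (_ ∷ p) (suc i) = vertex p i

  vertex-step : ∀ {l u w} (p : Walk G l u w) i → Adj G (vertex p (Fin.inject₁ i)) (vertex p (suc i))
  vertex-step (e ∷ [])        zero    = e
  vertex-step (e ∷ p@(_ ∷ _)) zero    = e
  vertex-step (e ∷ p)         (suc i) = vertex-step p i

  vertex-last : ∀ {l u w} (p : Walk G l u w) → vertex p (Fin.fromℕ l) ≡ w
  vertex-last []      = refl
  vertex-last (_ ∷ p) = vertex-last p

  Simple : ∀ {l u w} → Walk G l u w → Set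
  Simple p = ∀ {i j} → vertex p i ≡ vertex p j → i ≡ j

  Simple-∷ : ∀ {l u v w} {e : Adj G u v} {p : Walk G l v w} →
             (∀ i → u ≢ vertex p i) → Simple p → Simple (e ∷ p)
  Simple-∷ u∉ s {zero}  {zero}  _  = refl
  Simple-∷ u∉ s {zero}  {suc j} eq = contradiction eq (u∉ j)
  Simple-∷ u∉ s {suc i} {zero}  eq = contradiction (≡.sym eq) (u∉ i)
  Simple-∷ u∉ s {suc i} {suc j} eq = cong suc (s eq)

  simple⇒Cycle : ∀ {m u w} (p : Walk G (2 + m) u w) → Simple p → Adj G w u → Cycle G m
  simple⇒Cycle p s wu = record
    { c        = vertex p
    ; distinct = s
    ; step     = vertex-step p
    ; close    = subst (λ z → Adj G z _) (≡.sym (vertex-last p)) wu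
    }

  open Tree {E = Adj G} (adj-sym G) (adj-irrefl G)

  descending-walk : ∀ t → Valid (Adj G) t → ∀ {z} → z ∈ flat t →
                    ∃[ l ] Σ (Walk G l (root t) z) λ p → (∀ i → vertex p i ∈ flat t) × Simple p
  descending-walk = Rose-ind step
    where
    step : ∀ x cs → All (λ c → Valid (Adj G) c → ∀ {z} → z ∈ flat c →
             ∃[ l ] Σ (Walk G l (root c) z) λ p → (∀ i → vertex p i ∈ flat c) × Simple p) cs →
           Valid (Adj G) (node x cs) → ∀ {z} → z ∈ x ∷ flats cs →
           ∃[ l ] Σ (Walk G l x z) λ p → (∀ i → vertex p i ∈ x ∷ flats cs) × Simple p
    step x cs ih v (here refl) = 0 , [] , (λ { zero → here refl }) , λ { {zero} {zero} _ → refl }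
    step x cs ih v (there z∈)
      with c , c∈ , z∈c ← ∈-flats⁻ cs z∈
      with l , p , in-c , s ← All.lookup ih c∈ (Valid-child v c∈) z∈c =
      suc l , proj₁ (Valid-ChildOf v c∈) ∷ p ,
      (λ { zero → here refl ; (suc i) → there (∈-flats⁺ c∈ (in-c i)) }) ,
      Simple-∷ {e = proj₁ (Valid-ChildOf v c∈)} {p}
        (λ { i refl → proj₂ (proj₂ (Valid-ChildOf v c∈)) (in-c i) }) s

  -- The descent from the root to a second neighbour of `b` would close up through `b` to a cycle.
  single-attachment : (∀ m → ¬ Cycle G m) → ∀ {t b a} → Valid (Adj G) t → b ∉ flat t →
                      Adj G b (root t) → a ∈ flat t → Adj G b a → a ≡ root t
  single-attachment acyclic {t} v b∉ br a∈ ba with descending-walk t v a∈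
  ... | zero  , [] , _ , _ = refl
  ... | suc m , p , in-t , s = contradiction
    (simple⇒Cycle (br ∷ p) (Simple-∷ {e = br} {p} (λ { i refl → b∉ (in-t i) }) s) (adj-sym G ba)) (acyclic m)

  -- The root moves down one edge at a time; in the induction `ups` carries the part already turned
  -- over.
  reroot-at : ∀ t {a} → Valid (Adj G) t → a ∈ flat t →
              ∃[ ds ] Valid (Adj G) (node a ds) × flat (node a ds) ↭ flat t
  reroot-at t@(node _ _) {a} v a∈ = Rose-ind step t [] v a∈
    where
    P : Rose (Fin n) → Set
    P t = ∀ ups → Valid (Adj G) (node (root t) (ups ++ children t)) → a ∈ flat t →
      ∃[ ds ] Valid (Adj G) (node a ds) × flat (node a ds) ↭ flat (node (root t) (ups ++ children t))
    step : ∀ e cs → All P cs → P (node e cs)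
    step e cs ih ups v (here refl) = ups ++ cs , v , ↭-refl
    step e cs ih ups v (there a∈)
      with c@(node w ds) , c∈ , a∈c ← ∈-flats⁻ cs a∈
      with xs , ys , refl ← ∈-∃++ c∈ =
      let q = ↭-trans (++⁺ˡ ups (shift c xs ys)) (shift c ups (xs ++ ys))
          ds′ , v′ , p = All.lookup ih c∈ [ node e (ups ++ xs ++ ys) ] (Valid-reroot (Valid-resp-↭ q v)) a∈c
      in ds′ , v′ , ↭-trans p (↭-trans (↭-sym (flat-reroot e w ds (ups ++ xs ++ ys))) (prep e (flats-↭ (↭-sym q))))

  -- After rerooting at `a`, the new vertex `b` becomes a root with a single child, so the only new
  -- condition is that `b` has no second neighbour in the tree.
  attach : (∀ m → ¬ Cycle G m) → ∀ {t a b} → Valid (Adj G) t → a ∈ flat t → b ∉ flat t → Adj G a b →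
           ∃[ t′ ] Valid (Adj G) t′ × b ∈ flat t′ × (∀ {z} → z ∈ flat t → z ∈ flat t′)
  attach acyclic {t} {a} {b} v a∈ b∉ ab with ds , v′ , p ← reroot-at t v a∈ =
    node b [ node a ds ] ,
    valid ((adj-sym G ab , single-attachment acyclic v′ b∉′ (adj-sym G ab) , b∉′) ∷ []) ([] ∷ []) (v′ ∷ []) ,
    here refl , λ z∈ → there (∈-++⁺ˡ (∈-resp-↭ (↭-sym p) z∈))
    where
    b∉′ : b ∉ flat (node a ds)
    b∉′ b∈ = b∉ (∈-resp-↭ p b∈)

  extend : (∀ m → ¬ Cycle G m) → ∀ {l a v} → Walk G l a v → ∀ {t} → Valid (Adj G) t → a ∈ flat t →
           ∃[ t′ ] Valid (Adj G) t′ × v ∈ flat t′ × (∀ {z} → z ∈ flat t → z ∈ flat t′)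
  extend acyclic []      {t} vt a∈ = t , vt , a∈ , id
  extend acyclic (_∷_ {v = b} e p) {t} vt a∈ with member? Fin._≟_ b (flat t)
  ... | yes b∈ = extend acyclic p vt b∈
  ... | no  b∉ with t₁ , v₁ , b∈ , sub ← attach acyclic vt a∈ b∉ e
               with t₂ , v₂ , v∈ , sub′ ← extend acyclic p v₁ b∈ = t₂ , v₂ , v∈ , sub′ ∘ sub

  spanning : IsTree G → ∃[ t ] Valid (Adj G) t × (∀ v → v ∈ flat t)
  spanning T = let t , v , _ , all = cover (allFin n) in t , v , λ u → All.lookup all (∈-allFin u)
    where
    open IsTree T
    first : ∀ n → NonZero n → Fin n
    first (suc _) _ = zero
    r : Fin n
    r = first n nonEmpty
    cover : ∀ vs → ∃[ t ] Valid (Adj G) t × r ∈ flat t × All (_∈ flat t) vs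
    cover [] = node r [] , valid [] [] [] , here refl , []
    cover (v ∷ vs) with t , vt , r∈ , all ← cover vs
      with t′ , v′ , v∈ , sub ← extend acyclic (proj₂ (connected r v)) vt r∈ =
      t′ , v′ , sub r∈ , v∈ ∷ All.map sub all

-- The extremal families

Shape : Set
Shape = Rose ⊤

data Has {V : Set} : Shape → Rose V → Set where
  node : ∀ {s ss x ts} → Pointwise Has ss ts → Has (node s ss) (node x ts)

thrice : Shape → Shape
thrice s = node _ (s ∷ s ∷ s ∷ [])

-- The three copies below a neighbour of the centre already gain one in the square, since their
-- roots form a triangle there; in the tree they gain nothing.
doubling : ℕ → Shape
doubling zero    = node _ []
doubling (suc k) = node _ [ thrice (thrice (doubling k)) ]

-- The vertex between the centre and each copy keeps the chain through the centre away from the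
-- middle copy.
spider : ℕ → Shape
spider zero    = node _ []
spider (suc k) = thrice (node _ [ spider k ])

-- Edges leaving `p`, edges entering `q`, and the edge `r s`: once `p q`, `p s` and `r q` are edges,
-- any two of them conflict.
Cross : Rel V 0ℓ → (p q r s : V) → V × V → Set
Cross R p q r s (a , b) = R a b × (a ≡ p ⊎ b ≡ q ⊎ (a ≡ r × b ≡ s))

cross : ∀ {R : Rel V 0ℓ} {p q r s : V} {P : V × V → Set} {k} → R p q → R p s → R r q →
        (∀ M → All P M → AllPairs (Compatible R) M → length M ≤ k) → ∀ {M} →
        All (λ e → P e ⊎ Cross R p q r s e) M →
        AllPairs (Compatible R) M → length M ≤ suc k
cross pq ps rq = one-outside λ where
  (_ , inj₁ refl)                 (f , inj₁ refl)                 (¬e , _) → ¬e f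
  (_ , inj₁ refl)                 (_ , inj₂ (inj₁ refl))          (¬e , _) → ¬e pq
  (_ , inj₁ refl)                 (_ , inj₂ (inj₂ (refl , refl))) (¬e , _) → ¬e ps
  (_ , inj₂ (inj₁ refl))          (_ , inj₁ refl)                 (_ , ¬f) → ¬f pq
  (e , inj₂ (inj₁ refl))          (_ , inj₂ (inj₁ refl))          (¬e , _) → ¬e e
  (_ , inj₂ (inj₁ refl))          (_ , inj₂ (inj₂ (refl , refl))) (_ , ¬f) → ¬f rq
  (_ , inj₂ (inj₂ (refl , refl))) (_ , inj₁ refl)                 (_ , ¬f) → ¬f ps
  (_ , inj₂ (inj₂ (refl , refl))) (_ , inj₂ (inj₁ refl))          (¬e , _) → ¬e rq
  (e , inj₂ (inj₂ (refl , refl))) (_ , inj₂ (inj₂ (refl , refl))) (¬e , _) → ¬e e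

-- The order is chosen so that at every cut the edges outside the copy being cut form a single
-- `Cross`. Here `u₁` and `u₃` stand for the roots of the outer copies, the only vertices of these
-- copies that the square joins to the centre `x`.
module SpiderLayout {R : Rel V 0ℓ} {x v₁ v₂ v₃ u₁ u₃ : V} {L₁ L₂ L₃ : List V}
  (xv₂ : R x v₂) (xv₃ : R x v₃) (v₁x : R v₁ x) (v₁v₂ : R v₁ v₂) (u₁v₁ : R u₁ v₁) (v₃u₃ : R v₃ u₃)
  (L₁-rest : ∀ {a b} → a ∈ L₁ → b ∈ L₂ ++ v₂ ∷ v₃ ∷ L₃ → ¬ R a b)
  (L₂-rest : ∀ {a b} → a ∈ L₂ → b ∈ v₃ ∷ L₃ → ¬ R a b)
  (v₁-L₂ : ∀ {b} → b ∈ L₂ → ¬ R v₁ b) (v₁-L₃ : ∀ {b} → b ∈ L₃ → ¬ R v₁ b)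
  (v₂-L₃ : ∀ {b} → b ∈ L₃ → ¬ R v₂ b)
  (L₁-x : ∀ {a} → a ∈ L₁ → R a x → a ≡ u₁) (x-L₃ : ∀ {b} → b ∈ L₃ → R x b → b ≡ u₃)
  where

  module _ {k} (w₁ : Width R L₁ k) (w₂ : Width R L₂ k) (w₃ : Width R L₃ k) where

    cut-L₁ : ∀ A C → A ++ C ≡ L₁ → ∀ {M} →
             Matching R (_∈ A) (_∈ C ++ v₁ ∷ x ∷ L₂ ++ v₂ ∷ v₃ ∷ L₃) M → length M ≤ suc k
    cut-L₁ A C refl (cs , ps) = cross {P = Crossing R (_∈ A) (_∈ C)} {k} u₁v₁ u₁v₁ u₁v₁
      (λ _ cs ps → w₁ A C refl (cs , ps)) (All.map locate cs) ps
      where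
      locate : ∀ {e} → Crossing R (_∈ A) (_∈ C ++ v₁ ∷ x ∷ L₂ ++ v₂ ∷ v₃ ∷ L₃) e →
               Crossing R (_∈ A) (_∈ C) e ⊎ Cross R u₁ v₁ u₁ v₁ e
      locate (a∈ , b∈ , e) with ∈-++⁻ C b∈
      ... | inj₁ b∈C                 = inj₁ (a∈ , b∈C , e)
      ... | inj₂ (here refl)         = inj₂ (e , inj₂ (inj₁ refl))
      ... | inj₂ (there (here refl)) = inj₂ (e , inj₁ (L₁-x (∈-++⁺ˡ a∈) e))
      ... | inj₂ (there (there b∈))  = contradiction e (L₁-rest (∈-++⁺ˡ a∈) b∈)

    cut-v₁ : ∀ {M} → Matching R (_∈ L₁ ++ [ v₁ ]) (_∈ x ∷ L₂ ++ v₂ ∷ v₃ ∷ L₃) M → length M ≤ suc k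
    cut-v₁ (cs , ps) = cross {P = λ _ → ⊥} {k} v₁x v₁x v₁x
      (λ { [] _ _ → z≤n ; (_ ∷ _) (() ∷ _) _ }) (All.map (inj₂ ∘ locate) cs) ps
      where
      locate : ∀ {e} → Crossing R (_∈ L₁ ++ [ v₁ ]) (_∈ x ∷ L₂ ++ v₂ ∷ v₃ ∷ L₃) e →
               Cross R v₁ x v₁ x e
      locate (a∈ , b∈ , e) with ∈-++⁻ L₁ a∈ | b∈
      ... | inj₂ (here refl) | _         = e , inj₁ refl
      ... | inj₁ a∈L₁        | here refl = e , inj₂ (inj₁ refl)
      ... | inj₁ a∈L₁        | there b∈  = contradiction e (L₁-rest a∈L₁ b∈)

    -- The critical cut: `v₁ v₃` touches neither `x` nor `v₂`, but it conflicts with every edge at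
    -- either of them through `x v₃` and `v₁ v₂`.
    cut-L₂ : ∀ A C → A ++ C ≡ L₂ → ∀ {M} →
             Matching R (_∈ L₁ ++ v₁ ∷ x ∷ A) (_∈ C ++ v₂ ∷ v₃ ∷ L₃) M → length M ≤ suc k
    cut-L₂ A C refl (cs , ps) = cross {P = Crossing R (_∈ A) (_∈ C)} {k} xv₂ xv₃ v₁v₂
      (λ _ cs ps → w₂ A C refl (cs , ps)) (All.map locate cs) ps
      where
      later : ∀ {b} → b ∈ C ++ v₂ ∷ v₃ ∷ L₃ → b ∈ (A ++ C) ++ v₂ ∷ v₃ ∷ L₃
      later b∈ = subst (_ ∈_) (≡.sym (++-assoc A C _)) (∈-++⁺ʳ A b∈)
      locate : ∀ {e} → Crossing R (_∈ L₁ ++ v₁ ∷ x ∷ A) (_∈ C ++ v₂ ∷ v₃ ∷ L₃) e →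
               Crossing R (_∈ A) (_∈ C) e ⊎ Cross R x v₂ v₁ v₃ e
      locate (a∈ , b∈ , e) with ∈-++⁻ L₁ a∈ | ∈-++⁻ C b∈
      ... | inj₁ a∈L₁                | _                         = contradiction e (L₁-rest a∈L₁ (later b∈))
      ... | inj₂ (there (here refl)) | _                         = inj₂ (e , inj₁ refl)
      ... | inj₂ _                   | inj₂ (here refl)          = inj₂ (e , inj₂ (inj₁ refl))
      ... | inj₂ (here refl)         | inj₁ b∈C                  = contradiction e (v₁-L₂ (∈-++⁺ʳ A b∈C))
      ... | inj₂ (here refl)         | inj₂ (there (here refl))  = inj₂ (e , inj₂ (inj₂ (refl , refl)))
      ... | inj₂ (here refl)         | inj₂ (there (there b∈L₃)) = contradiction e (v₁-L₃ b∈L₃)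
      ... | inj₂ (there (there a∈A)) | inj₁ b∈C                  = inj₁ (a∈A , b∈C , e)
      ... | inj₂ (there (there a∈A)) | inj₂ (there b∈)           = contradiction e (L₂-rest (∈-++⁺ˡ a∈A) b∈)

    cut-v₂ : ∀ {M} → Matching R (_∈ L₁ ++ v₁ ∷ x ∷ L₂ ++ [ v₂ ]) (_∈ v₃ ∷ L₃) M → length M ≤ suc k
    cut-v₂ (cs , ps) = cross {P = λ _ → ⊥} {k} xv₃ xv₃ xv₃
      (λ { [] _ _ → z≤n ; (_ ∷ _) (() ∷ _) _ }) (All.map (inj₂ ∘ locate) cs) ps
      where
      locate : ∀ {e} → Crossing R (_∈ L₁ ++ v₁ ∷ x ∷ L₂ ++ [ v₂ ]) (_∈ v₃ ∷ L₃) e →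
               Cross R x v₃ x v₃ e
      locate (a∈ , here refl  , e) = e , inj₂ (inj₁ refl)
      locate (a∈ , there b∈L₃ , e) with ∈-++⁻ L₁ a∈
      ... | inj₁ a∈L₁                = contradiction e (L₁-rest a∈L₁ (∈-++⁺ʳ L₂ (there (there b∈L₃))))
      ... | inj₂ (here refl)         = contradiction e (v₁-L₃ b∈L₃)
      ... | inj₂ (there (here refl)) = e , inj₁ refl
      ... | inj₂ (there (there a∈)) with ∈-++⁻ L₂ a∈
      ...   | inj₁ a∈L₂        = contradiction e (L₂-rest a∈L₂ (there b∈L₃))
      ...   | inj₂ (here refl) = contradiction e (v₂-L₃ b∈L₃)

    cut-L₃ : ∀ A B → A ++ B ≡ L₃ → ∀ {M} →
             Matching R (_∈ L₁ ++ v₁ ∷ x ∷ L₂ ++ v₂ ∷ v₃ ∷ A) (_∈ B) M → length M ≤ suc k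
    cut-L₃ A B refl (cs , ps) = cross {P = Crossing R (_∈ A) (_∈ B)} {k} v₃u₃ v₃u₃ v₃u₃
      (λ _ cs ps → w₃ A B refl (cs , ps)) (All.map locate cs) ps
      where
      locate : ∀ {e} → Crossing R (_∈ L₁ ++ v₁ ∷ x ∷ L₂ ++ v₂ ∷ v₃ ∷ A) (_∈ B) e →
               Crossing R (_∈ A) (_∈ B) e ⊎ Cross R v₃ u₃ v₃ u₃ e
      locate (a∈ , b∈ , e) with ∈-++⁻ L₁ a∈
      ... | inj₁ a∈L₁                = contradiction e (L₁-rest a∈L₁ (∈-++⁺ʳ L₂ (there (there (∈-++⁺ʳ A b∈)))))
      ... | inj₂ (here refl)         = contradiction e (v₁-L₃ (∈-++⁺ʳ A b∈))
      ... | inj₂ (there (here refl)) = inj₂ (e , inj₂ (inj₁ (x-L₃ (∈-++⁺ʳ A b∈) e)))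
      ... | inj₂ (there (there a∈)) with ∈-++⁻ L₂ a∈
      ...   | inj₁ a∈L₂                 = contradiction e (L₂-rest a∈L₂ (there (∈-++⁺ʳ A b∈)))
      ...   | inj₂ (here refl)          = contradiction e (v₂-L₃ (∈-++⁺ʳ A b∈))
      ...   | inj₂ (there (here refl))  = inj₂ (e , inj₁ refl)
      ...   | inj₂ (there (there a∈A)) = inj₁ (a∈A , b∈ , e)

    width : Width R (L₁ ++ v₁ ∷ x ∷ L₂ ++ v₂ ∷ v₃ ∷ L₃) (suc k)
    width A B eq m with ++-split A B L₁ _ eq
    ... | inj₁ (C , eqA , refl)               = cut-L₁ A C (≡.sym eqA) m
    ... | inj₂ ([] , refl , refl)             = cut-L₁ A [] (≡.trans (++-identityʳ _) (++-identityʳ _)) m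
    ... | inj₂ (_ ∷ [] , refl , refl)         = cut-v₁ m
    ... | inj₂ (_ ∷ _ ∷ C , refl , eq′) with refl ← cong (take 2) eq′
      with ++-split C B L₂ _ (cong (drop 2) (≡.sym eq′))
    ...   | inj₁ (D , eqC , refl)             = cut-L₂ C D (≡.sym eqC) m
    ...   | inj₂ ([] , refl , refl)           = cut-L₂ C [] (≡.trans (++-identityʳ _) (++-identityʳ _)) m
    ...   | inj₂ (_ ∷ [] , refl , refl)       = cut-v₂ m
    ...   | inj₂ (_ ∷ _ ∷ D , refl , refl)    = cut-L₃ D B refl m

module Families {E : Rel V 0ℓ} (E-sym : Symmetric E) (E-irrefl : ∀ {x} → ¬ E x x) where
  open Tree {E = E} E-sym (λ {x} → E-irrefl {x})
  open Layouts {E = E} E-sym (λ {x} → E-irrefl {x})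

  -- Rooted at `x`, every neighbour is light, as the trees below the three hubs are copies of width
  -- `k`; both levels of branching together cost one.
  doubling-UB : ∀ k {t} → Has (doubling k) t → Valid E t → UB E (flat t) k
  doubling-UB zero    {node u []} (node []) v = [ u ] , ↭-refl , Width-[x]
  doubling-UB (suc k) {node u (node x hs ∷ [])} (node (node Hs ∷ [])) v =
    UB-resp-↭ (↭-sym (flat-reroot u x hs [])) (RootedUB⇒UB (node x (node u [] ∷ hs))
      (RootedUB-star (Valid-reroot v) ([] ∷ light Hs (All.tabulate (Valid-child (Valid-child v (here refl)))))))
    where
    ubs : ∀ {ss ts} → Pointwise Has ss ts → All (_≡ doubling k) ss → All (Valid E) ts → All (λ d → UB E (flat d) k) ts
    ubs []       []          []       = []
    ubs (h ∷ hs) (refl ∷ es) (v ∷ vs) = doubling-UB k h v ∷ ubs hs es vs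
    light : Pointwise Has (thrice (doubling k) ∷ thrice (doubling k) ∷ thrice (doubling k) ∷ []) hs →
            All (Valid E) hs → All (Light k) hs
    light (node p ∷ node q ∷ node r ∷ []) (valid _ _ a ∷ valid _ _ b ∷ valid _ _ c ∷ []) =
      ubs p (refl ∷ refl ∷ refl ∷ []) a ∷ ubs q (refl ∷ refl ∷ refl ∷ []) b ∷ ubs r (refl ∷ refl ∷ refl ∷ []) c ∷ []

  -- A triple in the square leaves its centre out of the matching, so each hub can serve at once as
  -- a branch of the next triple: two levels of branching gain two.
  doubling-LB² : ∀ k {t} → Has (doubling k) t → Valid E t → Convex E (flat t) →
                 LB (E² E) (flat t) (flats (children t)) (2 * k)
  doubling-LB² zero    {node u []} (node []) v conv = LB-0 (here refl)
  doubling-LB² (suc k) {node u (t@(node x hs) ∷ [])} (node (node (p ∷ q ∷ r ∷ []) ∷ [])) v conv =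
    subst (LB (E² E) (flat (node u (t ∷ []))) (flats (t ∷ []))) (cong suc (≡.sym (ℕ.+-suc k (k + 0))))
      (LB-mono (there ∘ there ∘ ∈-++⁺ˡ) (there ∘ ∈-++⁺ˡ)
        (LB²-triple vt ct (hub p (here refl)) (hub q (there (here refl))) (hub r (there (there (here refl))))))
    where
    vt : Valid E t
    vt = Valid-child v (here refl)
    ct : Convex E (flat t)
    ct = Convex-child v conv (here refl)
    hub : ∀ {h} → Has (thrice (doubling k)) h → h ∈ hs → LB (E² E) (flat h) (flats (children h)) (suc (2 * k))
    hub {node w ds} (node (p ∷ q ∷ r ∷ [])) h∈ =
      LB-mono there id (LB²-triple vh ch
        (copy p (here refl)) (copy q (there (here refl))) (copy r (there (there (here refl)))))
      where
      vh : Valid E (node w ds)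
      vh = Valid-child vt h∈
      ch : Convex E (flat (node w ds))
      ch = Convex-child vt ct h∈
      copy : ∀ {d} → Has (doubling k) d → d ∈ ds → LB (E² E) (flat d) (flats (children d)) (2 * k)
      copy h d∈ = doubling-LB² k h (Valid-child vh d∈) (Convex-child vh ch d∈)

  spider-LB : ∀ k {t} → Has (spider k) t → Valid E t → LB E (flat t) (flat t) k
  spider-LB zero    {node u []} (node []) v = LB-0 (here refl)
  spider-LB (suc k) {node x cs} (node (p ∷ q ∷ r ∷ [])) v =
    LB-triple v (leg p (here refl)) (leg q (there (here refl))) (leg r (there (there (here refl))))
    where
    leg : ∀ {c} → Has (node _ [ spider k ]) c → c ∈ cs → LB E (flat c) (flats (children c)) k
    leg {node w (f ∷ [])} (node (h ∷ [])) c∈ = LB-mono (there ∘ ∈-++⁺ˡ) ∈-++⁺ˡ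
      (spider-LB k h (Valid-child (Valid-child v c∈) (here refl)))

  E²-grandchild : ∀ {x cs c b} → Valid E (node x cs) → Convex E (flat (node x cs)) → c ∈ cs →
                  b ∈ flats (children c) → E² E x b → ∃[ d ] d ∈ children c × b ≡ root d
  E²-grandchild {c = c} v conv c∈ b∈ (_ , inj₁ e) = contradiction
    (subst (_∈ flats (children c)) (proj₁ (proj₂ (Valid-ChildOf v c∈)) (flats⊆flat c b∈) e) b∈)
    (root∉flats (Valid-child v c∈))
  E²-grandchild {x} {cs} {c@(node y ds)} {b} v@(valid _ ap _) conv c∈ b∈ (x≢b , inj₂ (m , e , f))
    with conv (here refl) (there (∈-flats⁺ c∈ (there b∈))) x≢b e f
  ... | here refl = contradiction e E-irrefl
  ... | there m∈ with g , g∈ , m∈g ← ∈-flats⁻ cs m∈ with AllPairs-lookup Apart-sym ap c∈ g∈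
  ...   | inj₂ c∥g = contradiction (E-sym f) (proj₂ (c∥g (there b∈) m∈g))
  ...   | inj₁ refl with refl ← proj₁ (proj₂ (Valid-ChildOf v c∈)) m∈g e
                    with d , d∈ , b∈d ← ∈-flats⁻ ds b∈ =
    d , d∈ , proj₁ (proj₂ (Valid-ChildOf (Valid-child v c∈) d∈)) b∈d f

  spider-join : ∀ {x v₁ v₂ v₃ f₁ f₂ f₃ k} →
                let t = node x (node v₁ [ f₁ ] ∷ node v₂ [ f₂ ] ∷ node v₃ [ f₃ ] ∷ []) in
                Valid E t → Convex E (flat t) →
                UB (E² E) (flat f₁) k → UB (E² E) (flat f₂) k → UB (E² E) (flat f₃) k → UB (E² E) (flat t) (suc k)
  spider-join {x} {v₁} {v₂} {v₃} {f₁} {f₂} {f₃} {k}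
    v@(valid _ ((c₁∥c₂ ∷ c₁∥c₃ ∷ []) ∷ (c₂∥c₃ ∷ []) ∷ _) _) conv (L₁ , p₁ , w₁) (L₂ , p₂ , w₂) (L₃ , p₃ , w₃) =
    L₁ ++ v₁ ∷ x ∷ L₂ ++ v₂ ∷ v₃ ∷ L₃ , perm , width w₁ w₂ w₃
    where
    c₁ c₂ c₃ : Rose V
    c₁ = node v₁ [ f₁ ]
    c₂ = node v₂ [ f₂ ]
    c₃ = node v₃ [ f₃ ]
    c₁∈ : c₁ ∈ c₁ ∷ c₂ ∷ c₃ ∷ []
    c₁∈ = here refl
    c₂∈ : c₂ ∈ c₁ ∷ c₂ ∷ c₃ ∷ []
    c₂∈ = there (here refl)
    c₃∈ : c₃ ∈ c₁ ∷ c₂ ∷ c₃ ∷ []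
    c₃∈ = there (there (here refl))

    below : ∀ {f L} → L ↭ flat f → ∀ {a} → a ∈ L → a ∈ flats [ f ]
    below p a∈ = ∈-++⁺ˡ (∈-resp-↭ p a∈)

    E-child : ∀ {c} → c ∈ c₁ ∷ c₂ ∷ c₃ ∷ [] → E x (root c)
    E-child c∈ = proj₁ (Valid-ChildOf v c∈)

    E²-grand : ∀ {w f} → node w [ f ] ∈ c₁ ∷ c₂ ∷ c₃ ∷ [] → E² E w (root f)
    E²-grand c∈ = E⊆E² (proj₁ (Valid-ChildOf (Valid-child v c∈) (here refl)))

    apartˡ : ∀ {c d} → c ∈ c₁ ∷ c₂ ∷ c₃ ∷ [] → d ∈ c₁ ∷ c₂ ∷ c₃ ∷ [] → Apart E c d →
             ∀ {a b} → a ∈ flats (children c) → b ∈ flat d → ¬ E² E a b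
    apartˡ {c} c∈ d∈ c∥d a∈ b∈ q = root∉flats (Valid-child v c∈)
      (subst (_∈ flats (children c)) (proj₁ (E²-between v conv c∈ d∈ c∥d (flats⊆flat c a∈) b∈ q)) a∈)

    apartʳ : ∀ {c d} → c ∈ c₁ ∷ c₂ ∷ c₃ ∷ [] → d ∈ c₁ ∷ c₂ ∷ c₃ ∷ [] → Apart E c d →
             ∀ {a b} → a ∈ flat c → b ∈ flats (children d) → ¬ E² E a b
    apartʳ {d = d} c∈ d∈ c∥d a∈ b∈ q = root∉flats (Valid-child v d∈)
      (subst (_∈ flats (children d)) (proj₂ (E²-between v conv c∈ d∈ c∥d a∈ (flats⊆flat d b∈) q)) b∈)

    only-root : ∀ {w f L} → node w [ f ] ∈ c₁ ∷ c₂ ∷ c₃ ∷ [] → L ↭ flat f → ∀ {a} → a ∈ L → E² E x a → a ≡ root f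
    only-root {w} {f} c∈ p a∈ q with _ , here refl , a≡ ← E²-grandchild v conv c∈ (below {f} p a∈) q = a≡

    L₁-rest : ∀ {a b} → a ∈ L₁ → b ∈ L₂ ++ v₂ ∷ v₃ ∷ L₃ → ¬ E² E a b
    L₁-rest a∈ b∈ with ∈-++⁻ L₂ b∈
    ... | inj₁ b∈L₂                 = apartˡ c₁∈ c₂∈ c₁∥c₂ (below {f₁} p₁ a∈) (there (below {f₂} p₂ b∈L₂))
    ... | inj₂ (here refl)          = apartˡ c₁∈ c₂∈ c₁∥c₂ (below {f₁} p₁ a∈) (here refl)
    ... | inj₂ (there (here refl))  = apartˡ c₁∈ c₃∈ c₁∥c₃ (below {f₁} p₁ a∈) (here refl)
    ... | inj₂ (there (there b∈L₃)) = apartˡ c₁∈ c₃∈ c₁∥c₃ (below {f₁} p₁ a∈) (there (below {f₃} p₃ b∈L₃))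

    L₂-rest : ∀ {a b} → a ∈ L₂ → b ∈ v₃ ∷ L₃ → ¬ E² E a b
    L₂-rest a∈ (here refl)  = apartˡ c₂∈ c₃∈ c₂∥c₃ (below {f₂} p₂ a∈) (here refl)
    L₂-rest a∈ (there b∈L₃) = apartˡ c₂∈ c₃∈ c₂∥c₃ (below {f₂} p₂ a∈) (there (below {f₃} p₃ b∈L₃))

    open SpiderLayout {R = E² E} {x} {v₁} {v₂} {v₃} {root f₁} {root f₃} {L₁} {L₂} {L₃}
      (E⊆E² (E-child c₂∈)) (E⊆E² (E-child c₃∈)) (E⊆E² (E-sym (E-child c₁∈)))
      (proj₁ (c₁∥c₂ (here refl) (here refl)) , inj₂ (x , E-sym (E-child c₁∈) , E-child c₂∈))
      (E²-sym (E²-grand c₁∈)) (E²-grand c₃∈) L₁-rest L₂-rest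
      (λ b∈ → apartʳ c₁∈ c₂∈ c₁∥c₂ (here refl) (below {f₂} p₂ b∈))
      (λ b∈ → apartʳ c₁∈ c₃∈ c₁∥c₃ (here refl) (below {f₃} p₃ b∈))
      (λ b∈ → apartʳ c₂∈ c₃∈ c₂∥c₃ (here refl) (below {f₃} p₃ b∈))
      (λ a∈ q → only-root c₁∈ p₁ a∈ (E²-sym q))
      (λ b∈ q → only-root c₃∈ p₃ b∈ q)

    open PermutationReasoning
    perm : L₁ ++ v₁ ∷ x ∷ L₂ ++ v₂ ∷ v₃ ∷ L₃ ↭ flat (node x (c₁ ∷ c₂ ∷ c₃ ∷ []))
    perm = begin
      L₁ ++ v₁ ∷ x ∷ L₂ ++ v₂ ∷ v₃ ∷ L₃          ↭⟨ shift v₁ L₁ _ ⟩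
      v₁ ∷ L₁ ++ x ∷ L₂ ++ v₂ ∷ v₃ ∷ L₃          ↭⟨ prep v₁ (shift x L₁ _) ⟩
      v₁ ∷ x ∷ L₁ ++ L₂ ++ v₂ ∷ v₃ ∷ L₃          ↭⟨ swap v₁ x (++⁺ˡ L₁ (shift v₂ L₂ _)) ⟩
      x ∷ v₁ ∷ L₁ ++ v₂ ∷ L₂ ++ v₃ ∷ L₃          ↭⟨ prep x (prep v₁ (++⁺ (flats-[] p₁) (prep v₂ (++⁺ (flats-[] p₂)
        (prep v₃ (↭-trans (flats-[] p₃) (↭-reflexive (≡.sym (++-identityʳ _))))))))) ⟩
      flat (node x (c₁ ∷ c₂ ∷ c₃ ∷ []))          ∎
      where
      flats-[] : ∀ {f L} → L ↭ flat f → L ↭ flats [ f ]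
      flats-[] p = ↭-trans p (↭-reflexive (≡.sym (++-identityʳ _)))

  spider-UB² : ∀ k {t} → Has (spider k) t → Valid E t → Convex E (flat t) → UB (E² E) (flat t) k
  spider-UB² zero    {node u []} (node []) v conv = [ u ] , ↭-refl , Width-[x]
  spider-UB² (suc k) {node x cs@(node _ (_ ∷ []) ∷ node _ (_ ∷ []) ∷ node _ (_ ∷ []) ∷ [])}
    (node (node (p ∷ []) ∷ node (q ∷ []) ∷ node (r ∷ []) ∷ [])) v conv =
    spider-join v conv (leg (here refl) p) (leg (there (here refl)) q) (leg (there (there (here refl))) r)
    where
    leg : ∀ {y f} → node y [ f ] ∈ cs → Has (spider k) f → UB (E² E) (flat f) k
    leg c∈ h = spider-UB² k h (Valid-child (Valid-child v c∈) (here refl))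
      (Convex-child (Valid-child v c∈) (Convex-child v conv c∈) (here refl))

-- Realising shapes as graphs

-- Vertices are addresses read from the vertex up to the root, so the parent is the tail.
data _≺_ : Rel (List ℕ) 0ℓ where
  parent : ∀ {i p} → p ≺ (i ∷ p)

Edge : Rel (List ℕ) 0ℓ
Edge p q = p ≺ q ⊎ q ≺ p

≺? : ∀ p q → Dec (p ≺ q)
≺? p []      = no λ ()
≺? p (i ∷ q) with ≡-dec ℕ._≟_ p q
... | yes refl = yes parent
... | no  p≢q  = no λ { parent → p≢q refl }

Edge-sym : Symmetric Edge
Edge-sym = Sum.swap

≺-irrefl : ∀ {p} → ¬ p ≺ p
≺-irrefl {_ ∷ _} ()

Edge-irrefl : ∀ {p} → ¬ Edge p p
Edge-irrefl (inj₁ e) = ≺-irrefl e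
Edge-irrefl (inj₂ e) = ≺-irrefl e

label  : Shape → List ℕ → Rose (List ℕ)
labels : List Shape → ℕ → List ℕ → List (Rose (List ℕ))
label  (node _ ss) p = node p (labels ss 0 p)
labels []       i p = []
labels (s ∷ ss) i p = label s (i ∷ p) ∷ labels ss (suc i) p

Has-label  : ∀ s p → Has s (label s p)
Has-labels : ∀ ss i p → Pointwise Has ss (labels ss i p)
Has-label  (node _ ss) p = node (Has-labels ss 0 p)
Has-labels []       i p = []
Has-labels (s ∷ ss) i p = Has-label s (i ∷ p) ∷ Has-labels ss (suc i) p

root-label : ∀ s p → root (label s p) ≡ p
root-label (node _ _) p = refl

∈-label  : ∀ s p {z} → z ∈ flat (label s p) → ∃[ q ] z ≡ q ++ p
∈-labels : ∀ ss i p {z} → z ∈ flats (labels ss i p) → ∃₂ λ q j → i ≤ j × z ≡ q ++ j ∷ p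
∈-label  (node _ ss) p (here refl) = [] , refl
∈-label  (node _ ss) p (there z∈) with q , j , _ , refl ← ∈-labels ss 0 p z∈ =
  q ++ [ j ] , ≡.sym (++-assoc q [ j ] p)
∈-labels (s ∷ ss) i p z∈ with ∈-++⁻ (flat (label s (i ∷ p))) z∈
... | inj₁ z∈s  with q , eq ← ∈-label s (i ∷ p) z∈s = q , i , ℕ.≤-refl , eq
... | inj₂ z∈ss with q , j , i<j , eq ← ∈-labels ss (suc i) p z∈ss = q , j , ℕ.<⇒≤ i<j , eq

++-∷-≢ : ∀ (q : List ℕ) i p → p ≢ q ++ i ∷ p
++-∷-≢ q i p eq = ℕ.<⇒≢ (ℕ.≤-trans (ℕ.n<1+n (length p)) (ℕ.m≤n+m (suc (length p)) (length q)))
  (≡.trans (cong length eq) (length-++ q))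

-- Both addresses end in `p`, so the entries just before it sit at the same depth; in the mixed
-- cases `p` would equal a proper extension of itself.
branch-unique : ∀ q q′ {i j p} → q ++ i ∷ p ≡ q′ ++ j ∷ p → i ≡ j
branch-unique []      []       eq = proj₁ (∷-injective eq)
branch-unique []      (_ ∷ q′) {j = j} {p} eq = contradiction (proj₂ (∷-injective eq)) (++-∷-≢ q′ j p)
branch-unique (_ ∷ q) []       {i} {p = p} eq = contradiction (≡.sym (proj₂ (∷-injective eq))) (++-∷-≢ q i p)
branch-unique (_ ∷ q) (_ ∷ q′) eq = branch-unique q q′ (proj₂ (∷-injective eq))

≺-branch : ∀ q q′ {i j p} → (q ++ i ∷ p) ≺ (q′ ++ j ∷ p) → i ≡ j
≺-branch q []       {i} {p = p} e with q ++ i ∷ p in eq | e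
... | _ | parent = contradiction (≡.sym eq) (++-∷-≢ q i p)
≺-branch q (_ ∷ q′) {i} {p = p} e with q ++ i ∷ p in eq | e
... | _ | parent = branch-unique q q′ eq

Valid-label : ∀ s p → Valid Edge (label s p)
Valid-labels : ∀ ss i p → All (ChildOf Edge p) (labels ss i p) × AllPairs (Apart Edge) (labels ss i p) ×
               All (Valid Edge) (labels ss i p)
Valid-label (node _ ss) p with ch , ap , vs ← Valid-labels ss 0 p = valid ch ap vs
Valid-labels []       i p = [] , [] , []
Valid-labels (s ∷ ss) i p with ch , ap , vs ← Valid-labels ss (suc i) p =
  childOf ∷ ch , All.tabulate (λ c∈ → apart c∈) ∷ ap , Valid-label s (i ∷ p) ∷ vs
  where
  only : ∀ {z} → z ∈ flat (label s (i ∷ p)) → Edge p z → z ≡ root (label s (i ∷ p))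
  only z∈ e with ∈-label s (i ∷ p) z∈
  only z∈ (inj₁ parent) | [] , refl = ≡.sym (root-label s (i ∷ p))
  only z∈ (inj₁ parent) | _ ∷ q , eq = contradiction (proj₂ (∷-injective eq)) (++-∷-≢ q i p)
  only z∈ (inj₂ (parent {j} {z})) | q , eq = contradiction (≡.trans (cong (j ∷_) eq) refl) (++-∷-≢ (j ∷ q) i (j ∷ z))
  childOf : ChildOf Edge p (label s (i ∷ p))
  childOf = subst (Edge p) (≡.sym (root-label s (i ∷ p))) (inj₁ parent) , only ,
    λ p∈ → let q , eq = ∈-label s (i ∷ p) p∈ in ++-∷-≢ q i p eq
  apart : ∀ {c} → c ∈ labels ss (suc i) p → Apart Edge (label s (i ∷ p)) c
  apart c∈ a∈ b∈
    with q , refl ← ∈-label s (i ∷ p) a∈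
    with q′ , j , i<j , refl ← ∈-labels ss (suc i) p (∈-flats⁺ c∈ b∈) =
    (λ eq → ℕ.<⇒≢ i<j (branch-unique q q′ eq)) ,
    λ { (inj₁ e) → ℕ.<⇒≢ i<j (≺-branch q q′ e) ; (inj₂ e) → ℕ.<⇒≢ i<j (≡.sym (≺-branch q′ q e)) }

module _ {V W : Set} (f : V → W) where

  mapR  : Rose V → Rose W
  mapRs : List (Rose V) → List (Rose W)
  mapR  (node x cs) = node (f x) (mapRs cs)
  mapRs []       = []
  mapRs (c ∷ cs) = mapR c ∷ mapRs cs

  root-mapR : ∀ t → root (mapR t) ≡ f (root t)
  root-mapR (node _ _) = refl

  flat-mapR  : ∀ t → flat (mapR t) ≡ map f (flat t)
  flats-mapRs : ∀ ts → flats (mapRs ts) ≡ map f (flats ts)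
  flat-mapR  (node x cs) = cong (f x ∷_) (flats-mapRs cs)
  flats-mapRs []       = refl
  flats-mapRs (c ∷ cs) = ≡.trans (≡.cong₂ _++_ (flat-mapR c) (flats-mapRs cs)) (≡.sym (map-++ f (flat c) (flats cs)))

  ∈-mapR : ∀ t {z} → z ∈ flat t → f z ∈ flat (mapR t)
  ∈-mapR t z∈ = subst (_ ∈_) (≡.sym (flat-mapR t)) (∈-map⁺ f z∈)

  Has-mapR⁻  : ∀ {s} t → Has s (mapR t) → Has s t
  Has-mapRs⁻ : ∀ {ss} ts → Pointwise Has ss (mapRs ts) → Pointwise Has ss ts
  Has-mapR⁻ (node x cs) (node h) = node (Has-mapRs⁻ cs h)
  Has-mapRs⁻ []       []      = []
  Has-mapRs⁻ (c ∷ cs) (h ∷ hs) = Has-mapR⁻ c h ∷ Has-mapRs⁻ cs hs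

  -- Used to relabel the tree of addresses by positions in the list of all addresses, which gives
  -- labels in `Fin`.
  mapR-surjective  : ∀ t → All (λ z → ∃[ i ] f i ≡ z) (flat t) → ∃[ t′ ] mapR t′ ≡ t
  mapRs-surjective : ∀ ts → All (λ z → ∃[ i ] f i ≡ z) (flats ts) → ∃[ ts′ ] mapRs ts′ ≡ ts
  mapR-surjective (node x cs) ((i , refl) ∷ hs) with cs′ , refl ← mapRs-surjective cs hs = node i cs′ , refl
  mapRs-surjective []       _  = [] , refl
  mapRs-surjective (c ∷ cs) hs
    with c′ , refl ← mapR-surjective c (Allₚ.++⁻ˡ (flat c) hs)
    with cs′ , refl ← mapRs-surjective cs (Allₚ.++⁻ʳ (flat c) hs) = c′ ∷ cs′ , refl

  module _ {E : Rel W 0ℓ} (f-injective : ∀ {x y} → f x ≡ f y → x ≡ y) where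

    E∘f : Rel V 0ℓ
    E∘f x y = E (f x) (f y)

    ChildOf-mapR⁻ : ∀ {x} c → ChildOf E (f x) (mapR c) → ChildOf E∘f x c
    ChildOf-mapR⁻ c (e , only , ∉) =
      subst (E _) (root-mapR c) e ,
      (λ z∈ e → f-injective (≡.trans (only (∈-mapR c z∈) e) (root-mapR c))) ,
      λ x∈ → ∉ (∈-mapR c x∈)

    Apart-mapR⁻ : ∀ c d → Apart E (mapR c) (mapR d) → Apart E∘f c d
    Apart-mapR⁻ c d ap a∈ b∈ with ne , ¬e ← ap (∈-mapR c a∈) (∈-mapR d b∈) = ne ∘ cong f , ¬e

    Valid-mapR⁻ : ∀ t → Valid E (mapR t) → Valid E∘f t
    Valid-mapRs⁻ : ∀ {x} cs → All (ChildOf E (f x)) (mapRs cs) → AllPairs (Apart E) (mapRs cs) →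
                   All (Valid E) (mapRs cs) → All (ChildOf E∘f x) cs × AllPairs (Apart E∘f) cs × All (Valid E∘f) cs
    All-Apart-mapR⁻ : ∀ c cs → All (Apart E (mapR c)) (mapRs cs) → All (Apart E∘f c) cs
    All-Apart-mapR⁻ c []       []       = []
    All-Apart-mapR⁻ c (d ∷ ds) (a ∷ as) = (λ {_} {_} → Apart-mapR⁻ c d a) ∷ All-Apart-mapR⁻ c ds as
    Valid-mapR⁻ (node x cs) (valid ch ap vs) with ch′ , ap′ , vs′ ← Valid-mapRs⁻ cs ch ap vs = valid ch′ ap′ vs′
    Valid-mapRs⁻ []       []        []        []       = [] , [] , []
    Valid-mapRs⁻ (c ∷ cs) (h ∷ ch) (a ∷ ap) (v ∷ vs) with ch′ , ap′ , vs′ ← Valid-mapRs⁻ cs ch ap vs =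
      ChildOf-mapR⁻ c h ∷ ch′ , All-Apart-mapR⁻ c cs a ∷ ap′ , Valid-mapR⁻ c v ∷ vs′

argmax : ∀ {n} (ρ : Fin (suc n) → ℕ) → ∃[ i ] ∀ j → ρ j ≤ ρ i
argmax {zero}  ρ = zero , λ { zero → ℕ.≤-refl }
argmax {suc n} ρ with i , max ← argmax (ρ ∘ suc) with ℕ.≤-total (ρ zero) (ρ (suc i))
... | inj₁ le = suc i , λ { zero → le ; (suc j) → max j }
... | inj₂ ge = zero , λ { zero → ℕ.≤-refl ; (suc j) → ℕ.≤-trans (max j) ge }

top? : ∀ {n} (i : Fin (suc n)) → i ≡ Fin.fromℕ n ⊎ ∃[ j ] i ≡ Fin.inject₁ j
top? i with view i
... | ‵fromℕ     = inj₁ refl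
... | ‵inject₁ j = inj₂ (j , refl)

inject₁-suc-asym : ∀ {n} (i j : Fin n) → Fin.inject₁ i ≡ suc j → suc i ≢ Fin.inject₁ j
inject₁-suc-asym i j p q = ℕ.<⇒≢ (ℕ.≤-trans (ℕ.n<1+n (toℕ j)) (ℕ.n≤1+n (suc (toℕ j)))) (begin
  toℕ j                ≡⟨ Fin.toℕ-inject₁ j ⟨
  toℕ (Fin.inject₁ j)  ≡⟨ cong toℕ q ⟨
  suc (toℕ i)          ≡⟨ cong suc (≡.trans (≡.sym (Fin.toℕ-inject₁ i)) (cong toℕ p)) ⟩
  suc (suc (toℕ j))    ∎)
  where open ≡.≡-Reasoning

module _ {n} {G : Graph n} {m} (C : Cycle G m) where
  open Cycle C

  two-neighbours : ∀ i → ∃₂ λ j j′ → j ≢ j′ × Adj G (c i) (c j) × Adj G (c i) (c j′)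
  two-neighbours zero = suc zero , Fin.fromℕ (2 + m) , (λ ()) , step zero , adj-sym G close
  two-neighbours (suc i) with top? (suc i)
  ... | inj₁ eq       = zero , Fin.inject₁ i , (λ 0≡ → zero≢ i eq (≡.sym 0≡)) ,
    subst (λ k → Adj G (c k) (c zero)) (≡.sym eq) close , adj-sym G (step i)
    where
    zero≢ : ∀ i → suc i ≡ Fin.fromℕ (2 + m) → Fin.inject₁ i ≢ zero
    zero≢ zero () _
    zero≢ (suc _) _ ()
  ... | inj₂ (j , eq) = suc j , Fin.inject₁ i , (λ eq′ → inject₁-suc-asym i j (≡.sym eq′) eq) ,
    subst (λ k → Adj G (c k) (c (suc j))) (≡.sym eq) (step j) , adj-sym G (step i)

-- A vertex of largest rank on a cycle would have two smaller neighbours.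
ranked⇒acyclic : ∀ {n} {G : Graph n} (ρ : Fin n → ℕ) →
  (∀ {u v w} → Adj G u v → Adj G u w → ρ v ≤ ρ u → ρ w ≤ ρ u → v ≡ w) → ∀ m → ¬ Cycle G m
ranked⇒acyclic ρ unique m C with i , max ← argmax (ρ ∘ Cycle.c C) with j , j′ , j≢j′ , e , e′ ← two-neighbours C i =
  j≢j′ (Cycle.distinct C (unique e e′ (max j) (max j′)))

record Realisation (s : Shape) : Set₁ where
  field
    {order} : ℕ
    graph   : Graph order
    tree    : Rose (Fin order)
    isTree  : IsTree graph
    is-valid : Valid (Adj graph) tree
    covers  : ∀ v → v ∈ flat tree
    has     : Has s tree

realise : ∀ s → Realisation s
realise s@(node _ _) = record
  { graph    = G
  ; tree     = t
  ; isTree   = record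
    { nonEmpty  = _
    ; connected = connected
    -- The rank is the depth: the only neighbour of a vertex that is not deeper is its parent.
    ; acyclic   = ranked⇒acyclic {G = G} (length ∘ f) (λ {u} → parent-unique {u})
    }
  ; is-valid = t-valid
  ; covers   = covers
  ; has      = Has-mapR⁻ f t (subst (Has s) (≡.sym t≡) (Has-label s []))
  }
  where
  xs : List (List ℕ)
  xs = flat (label s [])
  f : Fin (length xs) → List ℕ
  f = lookup xs
  f-injective : ∀ {i j} → f i ≡ f j → i ≡ j
  f-injective = lookup-injective (Tree.Valid⇒Unique Edge-sym Edge-irrefl (Valid-label s []))
  G : Graph (length xs)
  G = record
    { Adj        = λ i j → Edge (f i) (f j)
    ; adj?       = λ i j → ≺? (f i) (f j) ⊎-dec ≺? (f j) (f i)
    ; adj-sym    = Edge-sym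
    ; adj-irrefl = Edge-irrefl
    }
  G-sym : Symmetric (Adj G)
  G-sym {u} {v} = adj-sym G {u} {v}
  lifted : ∃[ t ] mapR f t ≡ label s []
  lifted = mapR-surjective f (label s []) (All.tabulate λ z∈ → index z∈ , ≡.sym (Anyₚ.lookup-index z∈))
  t : Rose (Fin (length xs))
  t = proj₁ lifted
  t≡ : mapR f t ≡ label s []
  t≡ = proj₂ lifted
  t-valid : Valid (Adj G) t
  t-valid = Valid-mapR⁻ f f-injective t (subst (Valid Edge) (≡.sym t≡) (Valid-label s []))
  covers : ∀ v → v ∈ flat t
  covers v with z , z∈ , eq ← ∈-map⁻ f (subst (f v ∈_) (≡.trans (cong flat (≡.sym t≡)) (flat-mapR f t)) (∈-lookup v)) =
    subst (_∈ flat t) (≡.sym (f-injective eq)) z∈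
  parent-unique : ∀ {u v w} → Edge (f u) (f v) → Edge (f u) (f w) → length (f v) ≤ length (f u) →
                  length (f w) ≤ length (f u) → v ≡ w
  parent-unique e e′ le le′ = f-injective (same e e′ le le′)
    where
    same : ∀ {p q r} → Edge p q → Edge p r → length q ≤ length p → length r ≤ length p → q ≡ r
    same (inj₁ parent) _             le _   = contradiction le (ℕ.<⇒≱ (ℕ.n<1+n _))
    same _             (inj₁ parent) _  le′ = contradiction le′ (ℕ.<⇒≱ (ℕ.n<1+n _))
    same (inj₂ parent) (inj₂ parent) _  _   = refl
  chain⇒walk : ∀ {u v} → Chain (Adj G) (λ _ → ⊤) u v → ∃[ l ] Walk G l u v
  chain⇒walk ε                  = 0 , []
  chain⇒walk ((_ , _ , e) ◅ es) = let l , p = chain⇒walk es in suc l , e ∷ p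
  connected : Connected G
  connected u v = chain⇒walk (Chain-reverse {Q = Adj G} (λ {x} {y} → G-sym {x} {y}) (from-root u) ◅◅ from-root v)
    where
    from-root : ∀ v → Chain (Adj G) (λ _ → ⊤) (root t) v
    from-root v = Tree.root-Chain {E = Adj G} (λ {x} {y} → G-sym {x} {y}) (λ {x} → adj-irrefl G {x})
      {Q = Adj G} {P = λ _ → ⊤} id t t-valid _ (covers v)

-- The two inequalities and their tightness

spanning-Convex : ∀ {n} {E : Rel (Fin n) 0ℓ} {S} → (∀ v → v ∈ S) → Convex E S
spanning-Convex covers _ _ _ _ _ = covers _

lmw≤lmw² : ∀ {n} (T : Graph n) → IsTree T → lmw T ≤ lmw (T ²)
lmw≤lmw² T isTree with lmw T in eq
... | zero  = z≤n
... | suc m with t , v , covers ← spanning isTree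
            -- The dichotomy is taken one below the width of `T`, where a layout of the tree is
            -- impossible.
            with Layouts.dichotomy {E = Adj T} (adj-sym T) (adj-irrefl T) m t v (spanning-Convex {E = Adj T} covers)
...   | inj₂ lb = LB²⇒≤lmw² {G = T} lb
...   | inj₁ ub = contradiction
  (ℕ.≤-trans (ℕ.≤-reflexive (≡.sym eq)) (UB⇒lmw≤ {G = T} (Tree.Valid⇒Unique (adj-sym T) (adj-irrefl T) v) covers ub))
  ℕ.1+n≰n

module Realised {s : Shape} (𝑇 : Realisation s) where
  open Realisation 𝑇 public

  unique : Unique (flat tree)
  unique = Tree.Valid⇒Unique (adj-sym graph) (λ {x} → adj-irrefl graph {x}) is-valid

  convex : Convex (Adj graph) (flat tree)
  convex = spanning-Convex {E = Adj graph} covers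

  open Families {E = Adj graph} (adj-sym graph) (λ {x} → adj-irrefl graph {x}) public

theorem1 : (∀ {n : ℕ} (T : Graph n) → IsTree T → ∀ (k : ℕ) → lmw T ≡ k →
    k ≤ lmw (T ²) × lmw (T ²) ≤ 2 * k)
    ×
    (∀ (k : ℕ) →
    (∃[ n ] Σ[ T ∈ Graph n ] IsTree T × lmw T ≡ k × lmw (T ²) ≡ k)
    ×
    (∃[ n ] Σ[ T′ ∈ Graph n ] IsTree T′ × lmw T′ ≡ k × lmw (T′ ²) ≡ 2 * k))
theorem1 = (λ { T isTree _ refl → lmw≤lmw² T isTree , lmw²≤2*lmw T }) , λ k → tight-below k , tight-above k
  where
  tight-below : ∀ k → ∃[ n ] Σ[ T ∈ Graph n ] IsTree T × lmw T ≡ k × lmw (T ²) ≡ k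
  tight-below k = order , graph , isTree ,
    -- A lower bound for the tree and an upper bound for its square suffice, since the general
    -- inequality squeezes both widths to `k`.
    ℕ.≤-antisym (ℕ.≤-trans (lmw≤lmw² graph isTree) upper) lower ,
    ℕ.≤-antisym upper (ℕ.≤-trans lower (lmw≤lmw² graph isTree))
    where
    open Realised (realise (spider k))
    lower : k ≤ lmw graph
    lower = LB⇒≤lmw {G = graph} (spider-LB k has is-valid)
    upper : lmw (graph ²) ≤ k
    upper = UB²⇒lmw²≤ {G = graph} unique covers (spider-UB² k has is-valid convex)

  tight-above : ∀ k → ∃[ n ] Σ[ T′ ∈ Graph n ] IsTree T′ × lmw T′ ≡ k × lmw (T′ ²) ≡ 2 * k
  tight-above k = order , graph , isTree ,
    -- The lower bound for the tree comes from its square: `2 * k` is at most the width of the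
    -- square, hence at most twice the width of the tree.
    ℕ.≤-antisym upper (ℕ.*-cancelˡ-≤ 2 (ℕ.≤-trans lower (lmw²≤2*lmw graph))) ,
    ℕ.≤-antisym (ℕ.≤-trans (lmw²≤2*lmw graph) (ℕ.*-monoʳ-≤ 2 upper)) lower
    where
    open Realised (realise (doubling k))
    lower : 2 * k ≤ lmw (graph ²)
    lower = LB²⇒≤lmw² {G = graph} (doubling-LB² k has is-valid convex)
    upper : lmw graph ≤ k
    upper = UB⇒lmw≤ {G = graph} unique covers (doubling-UB k has is-valid)
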